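{- For every $\varepsilon>0$ there exist constants $p_0=p_0(\varepsilon)$ and $c=c(\varepsilon)>0$, depending only on $\varepsilon$, such that for every prime $p\ge p_0$, every integer $g\ge 2$ with $\gcd(g,p)=1$ of multiplicative order $t$ modulo $p$, every integer $M$ with $1\le M<t$, every integer $a$ with $\gcd(a,p)=1$, and all integers $K,L$, $$J_a(M;K,L)< c\,\bigl(1+M^{3/4}p^{ -1/4}\bigr)M^{1/2+\varepsilon}.$$
   Context: $J_a(M;K,L)$ denotes the number of pairs of integers $(x,y)$ with $y\equiv a g^x\pmod p$, $x\in[K+1,K+M]$, $y\in[L+1,L+M]$; for negative $x$, $g^x$ is understood via the inverse of $g$ modulo $p$. -}

module Defs where

open import Algebra.Definitions.RawSemiring using () renaming (_^_ to pow)
open import Data.Integer as ℤ using (ℤ; +_; -[1+_])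
open import Data.Integer.Divisibility.Signed using (_∣_; _∣?_; divides)
import Data.Integer.Properties as ℤ
open import Data.List using (List; map; upTo; filter; length; cartesianProduct)
open import Data.Nat as ℕ using (ℕ; suc)
open import Data.Nat.Coprimality using (Coprime; coprime-Bézout; coprime⇒gcd≡1)
open import Data.Nat.GCD using (gcd-GCD; module Bézout)
open import Data.Product using (_×_; _,_; ∃-syntax)
open import Data.Rational as ℚ using (ℚ; 0ℚ; 1ℚ; ↥_; ↧ₙ_; +-*-rawSemiring)
open import Data.Sum using (_⊎_)
open import Function using (_⇔_)
open import Relation.Binary.PropositionalEquality
  using (_≡_; refl; cong; module ≡-Reasoning)
open import Relation.Nullary using (Dec; ¬_)

------------------------------------------------------------------------
-- Congruences and modular powers

infix 4 _≡_[mod_] _≡?_[mod_]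

_≡_[mod_] : ℤ → ℤ → ℕ → Set
x ≡ y [mod n ] = + n ∣ (x ℤ.- y)

_≡?_[mod_] : (x y : ℤ) (n : ℕ) → Dec (x ≡ y [mod n ])
x ≡? y [mod n ] = + n ∣? (x ℤ.- y)

-- The Bézout coefficient of g for the pair (g , n).  It is an inverse of
-- g modulo n when g and n are coprime, and irrelevant otherwise.

bézoutCoefficient : ∀ {d g n} → Bézout.Identity d g n → ℤ
bézoutCoefficient (Bézout.+- x _ _) = + x
bézoutCoefficient (Bézout.-+ x _ _) = ℤ.- (+ x)

inverse : ℕ → ℕ → ℤ
inverse g n = bézoutCoefficient (Bézout.identity (gcd-GCD g n))

bézoutCoefficient-inverse : ∀ {g n} (b : Bézout.Identity 1 g n) →
  + g ℤ.* bézoutCoefficient b ≡ + 1 [mod n ]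
bézoutCoefficient-inverse {g} {n} (Bézout.+- x y eq) = divides (+ y) (begin
  + g ℤ.* + x ℤ.- + 1                ≡⟨ cong (ℤ._- + 1) (ℤ.*-comm (+ g) (+ x)) ⟩
  + x ℤ.* + g ℤ.- + 1                ≡⟨ cong (ℤ._- + 1) (ℤ.pos-* x g) ⟨
  + (x ℕ.* g) ℤ.- + 1                ≡⟨ cong (λ k → + k ℤ.- + 1) eq ⟨
  + 1 ℤ.+ + (y ℕ.* n) ℤ.- + 1        ≡⟨ cong (ℤ._- + 1) (ℤ.+-comm (+ 1) (+ (y ℕ.* n))) ⟩
  + (y ℕ.* n) ℤ.+ + 1 ℤ.- + 1        ≡⟨ ℤ.+-assoc (+ (y ℕ.* n)) (+ 1) (ℤ.- + 1) ⟩
  + (y ℕ.* n) ℤ.+ + 0                ≡⟨ ℤ.+-identityʳ (+ (y ℕ.* n)) ⟩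
  + (y ℕ.* n)                        ≡⟨ ℤ.pos-* y n ⟩
  + y ℤ.* + n                        ∎)
  where open ≡-Reasoning
bézoutCoefficient-inverse {g} {n} (Bézout.-+ x y eq) = divides (ℤ.- (+ y)) (begin
  + g ℤ.* (ℤ.- + x) ℤ.- + 1          ≡⟨ cong (ℤ._- + 1) (ℤ.neg-distribʳ-* (+ g) (+ x)) ⟨
  ℤ.- (+ g ℤ.* + x) ℤ.- + 1          ≡⟨ cong (λ k → ℤ.- k ℤ.- + 1) (ℤ.*-comm (+ g) (+ x)) ⟩
  ℤ.- (+ x ℤ.* + g) ℤ.- + 1          ≡⟨ cong (λ k → ℤ.- k ℤ.- + 1) (ℤ.pos-* x g) ⟨
  ℤ.- (+ (x ℕ.* g)) ℤ.- + 1          ≡⟨ ℤ.neg-distrib-+ (+ (x ℕ.* g)) (+ 1) ⟨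
  ℤ.- (+ (x ℕ.* g) ℤ.+ + 1)          ≡⟨ cong ℤ.-_ (ℤ.+-comm (+ (x ℕ.* g)) (+ 1)) ⟩
  ℤ.- (+ 1 ℤ.+ + (x ℕ.* g))          ≡⟨ cong (λ k → ℤ.- (+ k)) eq ⟩
  ℤ.- (+ (y ℕ.* n))                  ≡⟨ cong ℤ.-_ (ℤ.pos-* y n) ⟩
  ℤ.- (+ y ℤ.* + n)                  ≡⟨ ℤ.neg-distribˡ-* (+ y) (+ n) ⟩
  (ℤ.- + y) ℤ.* + n                  ∎)
  where open ≡-Reasoning

inverse-correct : ∀ {g n} → Coprime g n → + g ℤ.* inverse g n ≡ + 1 [mod n ]
inverse-correct {g} {n} c = go (coprime⇒gcd≡1 c) (Bézout.identity (gcd-GCD g n))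
  where
  go : ∀ {d} → d ≡ 1 → (b : Bézout.Identity d g n) →
       + g ℤ.* bézoutCoefficient b ≡ + 1 [mod n ]
  go refl b = bézoutCoefficient-inverse b

-- An integer representing g ^ x modulo n.

powMod : ℕ → ℕ → ℤ → ℤ
powMod n g (+ k)    = (+ g) ℤ.^ k
powMod n g -[1+ k ] = inverse g n ℤ.^ suc k

record IsMultiplicativeOrder (n g t : ℕ) : Set where
  field
    positive : 0 ℕ.< t
    power≡1  : (+ g) ℤ.^ t ≡ + 1 [mod n ]
    minimal  : ∀ s → 0 ℕ.< s → (+ g) ℤ.^ s ≡ + 1 [mod n ] → t ℕ.≤ s

------------------------------------------------------------------------
-- The counting function

-- The integers in [K + 1 , K + M].

interval : ℤ → ℕ → List ℤ
interval K M = map (λ i → K ℤ.+ + suc i) (upTo M)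

OnCurve : (p g : ℕ) (a : ℤ) → ℤ × ℤ → Set
OnCurve p g a (x , y) = y ≡ a ℤ.* powMod p g x [mod p ]

onCurve? : ∀ p g a xy → Dec (OnCurve p g a xy)
onCurve? p g a (x , y) = y ≡? a ℤ.* powMod p g x [mod p ]

Jₐ : (p g : ℕ) (a : ℤ) (M : ℕ) (K L : ℤ) → ℕ
Jₐ p g a M K L =
  length (filter (onCurve? p g a)
                 (cartesianProduct (interval K M) (interval L M)))

------------------------------------------------------------------------
-- Real numbers

-- Dedekind reals: lower q means q < x and upper q means x < q.

record ℝ : Set₁ where
  field
    lower upper     : ℚ → Set
    lower-inhabited : ∃[ q ] lower q
    upper-inhabited : ∃[ q ] upper q
    lower-rounded   : ∀ q → lower q ⇔ (∃[ r ] q ℚ.< r × lower r)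
    upper-rounded   : ∀ q → upper q ⇔ (∃[ r ] r ℚ.< q × upper r)
    disjoint        : ∀ q → ¬ (lower q × upper q)
    located         : ∀ q r → q ℚ.< r → lower q ⊎ upper r

open ℝ public using (lower)

Positive : ℝ → Set
Positive x = lower x 0ℚ

-- A strict bound q < e with q rational only involves the rationals below
-- e, so compound real expressions e are represented by their lower cuts.

LowerCut : Set₁
LowerCut = ℚ → Set

infix  4 _<ᶜ_
infixl 6 _+ᶜ_
infixl 7 _*ᶜ_
infixr 8 _^ʳ_ _^ᶜ_ _^ℚ_

_<ᶜ_ : ℚ → LowerCut → Set
q <ᶜ X = X q

⌊_⌋ : ℚ → LowerCut
⌊ r ⌋ q = q ℚ.< r

_+ᶜ_ : LowerCut → LowerCut → LowerCut
(X +ᶜ Y) q = ∃[ r ] ∃[ s ] X r × Y s × q ℚ.≤ r ℚ.+ s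

-- Only meaningful for cuts of positive reals.

_*ᶜ_ : LowerCut → LowerCut → LowerCut
(X *ᶜ Y) q =
  ∃[ r ] ∃[ s ] 0ℚ ℚ.< r × 0ℚ ℚ.< s × X r × Y s × q ℚ.≤ r ℚ.* s

_^ℚ_ : ℚ → ℕ → ℚ
_^ℚ_ = pow +-*-rawSemiring

-- For q > 0, u an integer and v > 0:  q < b ^ (u / v) iff q ^ v < b ^ u,
-- and a negative power of b is moved to the left-hand side.

PowerBelow : ℚ → ℕ → ℤ → ℕ → Set
PowerBelow q b (+ k)    v = q ^ℚ v ℚ.< (+ (b ℕ.^ k)) ℚ./ 1
PowerBelow q b -[1+ k ] v = q ^ℚ v ℚ.* ((+ (b ℕ.^ suc k)) ℚ./ 1) ℚ.< 1ℚ

-- The lower cut of b ^ r for a positive base b and a rational exponent r.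

_^ʳ_ : ℕ → ℚ → LowerCut
(b ^ʳ r) q = q ℚ.≤ 0ℚ ⊎ PowerBelow q b (↥ r) (↧ₙ r)

-- The real power b ^ s as the supremum of b ^ r over rationals r < s.
-- As b ^ r must be nondecreasing in r, the base is required to be at least 1.

_^ᶜ_ : ℕ → LowerCut → LowerCut
(b ^ᶜ S) q = ∃[ r ] S r × (b ^ʳ r) q

{-# OPTIONS --safe #-}

-- If (x₁ , y₁) and (x₂ , y₂) lie on the curve y ≡ a g ^ x, then y₁ y₂ depends modulo p only
-- on s = x₁ + x₂, which takes at most 2 M values; so J² is at most 2 M times the number of
-- points of a modular hyperbola y₁ y₂ ≡ λ in a square of side M.  Writing yᵢ = L + uᵢ and
-- choosing r ≤ R with r L ≡ L₀ and R |L₀| < p, the number w = r u₁ u₂ + L₀ (u₁ + u₂) is fixed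
-- modulo p.  As |w| ≤ r M² + 2 |L₀| M, for R ≈ √(p / M) it takes O(1 + M ^ 3/2 p ^ -1/2)
-- values, and each of them leaves M ^ o(1) pairs (u₁ , u₂) by the divisor bound.
module Submission where

open import Defs
open import Data.Integer as ℤ using (ℤ; +_; -[1+_])
open import Data.Integer.Coprimality using () renaming (Coprime to Coprimeℤ)
open import Data.Nat using (ℕ; _≤_; _<_)
open import Data.Nat.Coprimality using (Coprime)
open import Data.Nat.Primality using (Prime)
open import Data.Product using (_×_; Σ-syntax)
open import Data.Rational using (_/_; 1ℚ)

open import Algebra.Properties.AbelianGroup using (∙-cancelˡ; ∙-cancelʳ)
open import Data.Fin as Fin using (Fin; toℕ; fromℕ<)
import Data.Fin.Properties as Fin
open import Data.Integer using (0ℤ; ∣_∣)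
import Data.Integer.DivMod as ℤ
open import Data.Integer.Divisibility.Signed as ℤ using (divides)
import Data.Integer.Properties as ℤ
import Data.Integer.Tactic.RingSolver as ℤ-solver
open import Data.List using (List; []; _∷_; _++_; length; map; filter; cartesianProduct; upTo)
open import Data.List.Membership.Propositional using (_∈_; find)
open import Data.List.Membership.Propositional.Properties
  using (∈-map⁺; ∈-map⁻; ∈-++⁺ˡ; ∈-++⁺ʳ; ∈-filter⁺; ∈-filter⁻; ∈-upTo⁺; ∈-upTo⁻;
         ∈-cartesianProduct⁺; ∈-cartesianProduct⁻)
open import Data.List.Properties using (length-++; length-map; length-upTo)
open import Data.List.Relation.Unary.All as All using (All; []; _∷_)
import Data.List.Relation.Unary.All.Properties as All
open import Data.List.Relation.Unary.AllPairs using (_∷_)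
open import Data.List.Relation.Unary.Any using (here; there)
open import Data.List.Relation.Unary.Unique.Propositional using (Unique)
import Data.List.Relation.Unary.Unique.Propositional.Properties as Unique
open import Data.Nat as ℕ using (zero; suc; z≤n; s≤s; NonZero)
import Data.Nat.DivMod as ℕ
open import Data.Nat.Divisibility as ℕ using ()
open import Data.Nat.Induction using (<-rec)
open import Data.Nat.ListAction using (product)
open import Data.Nat.ListAction.Properties using (∈⇒∣product)
open import Data.Nat.Primality
  using (_Rough_; 2-rough; ∤⇒rough-suc; rough∧∣⇒prime; rough∧∣⇒rough; rough⇒≤; euclidsLemma;
         prime⇒nonZero; prime⇒nonTrivial)
open import Data.Nat.Primality.Factorisation using (factorise; PrimeFactorisation)
import Data.Nat.Properties as ℕ
import Data.Nat.Tactic.RingSolver as ℕ-solver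
open import Data.Product using (_,_; proj₁; proj₂; ∃-syntax)
open import Data.Product.Properties using (≡-dec)
open import Data.Rational as ℚ using (ℚ; mkℚ; 0ℚ; ½; toℚᵘ; ↥_; ↧ₙ_)
import Data.Rational.Properties as ℚ
open import Data.Rational.Unnormalised as ℚᵘ using (mkℚᵘ)
import Data.Rational.Unnormalised.Properties as ℚᵘ
open import Data.Sum using (_⊎_; inj₁; inj₂; [_,_]′)
open import Function using (_∘_; case_of_; id; mk⇔; Equivalence)
open import Relation.Binary.Definitions using (DecidableEquality; tri<; tri≈; tri>)
open import Relation.Binary.PropositionalEquality
  using (_≡_; _≢_; refl; sym; trans; cong; cong₂; subst; subst₂)
open import Relation.Nullary using (Dec; yes; no; ¬_; contradiction)
open import Relation.Nullary.Decidable using (¬?)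

-- The obstacle is uniformity in M. The identity (r u₁ + L₀)(r u₂ + L₀) = r w + L₀² already invites
-- a divisor bound, but its right-hand side is bounded only in terms of p, and p ^ o(1) need not be
-- M ^ o(1). Two points on the line r X + L₀ Y = w, where X = u₁ u₂ and Y = u₁ + u₂, let r and L₀ be
-- replaced by integers of size O(M²), and the number to be factored becomes O(M⁴). The size of R
-- balances the two terms of |w|: r M² ≤ R M² and |L₀| M < p M / R agree up to constants when R² M ≈
-- p. Real powers appear only at the very end. Until then M ^ (1/2 + ε) is represented by an
-- exponent u / v with v < 2 u, and every root by an integer floor with a generous constant. The
-- slack v + 1 ≤ 2 u is what absorbs the divisor bound.

-- Counting through fibres

-- Quantifying over repetition-free lists bounds a cardinality while `P` is neither decidable nor
-- enumerated.
AtMost : ∀ {A : Set} → ℕ → (A → Set) → Set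
AtMost n P = ∀ {xs} → Unique xs → All P xs → length xs ≤ n

length-filter-¬ : ∀ {A : Set} {P : A → Set} (P? : ∀ x → Dec (P x)) xs →
  length xs ≡ length (filter P? xs) ℕ.+ length (filter (¬? ∘ P?) xs)
length-filter-¬ P? [] = refl
length-filter-¬ P? (x ∷ xs) with P? x
... | yes _ = cong suc (length-filter-¬ P? xs)
... | no  _ = trans (cong suc (length-filter-¬ P? xs)) (sym (ℕ.+-suc _ _))

-- Induction on `ys`: the fibre over the head is split off, and the remaining elements satisfy the
-- stronger predicate `P x × f x ≢ y`, whose values lie in the tail.
atMost-fibres : ∀ {A B : Set} {P : A → Set} {n} → DecidableEquality B → (f : A → B) (ys : List B) →
  (∀ {x} → P x → f x ∈ ys) →
  (∀ y → AtMost n (λ x → P x × f x ≡ y)) →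
  AtMost (length ys ℕ.* n) P
atMost-fibres _≟_ f [] f∈ fib {[]} u ps = z≤n
atMost-fibres _≟_ f [] f∈ fib {x ∷ xs} u (p ∷ ps) with () ← f∈ p
atMost-fibres {P = P} {n = n} _≟_ f (y ∷ ys) f∈ fib {xs} u ps = begin
  length xs                            ≡⟨ length-filter-¬ y? xs ⟩
  length (filter y? xs) ℕ.+ length (filter (¬? ∘ y?) xs)
    ≤⟨ ℕ.+-mono-≤
         (fib y (Unique.filter⁺ y? u)
                (All.zip (All.filter⁺ y? ps , All.all-filter y? xs)))
         (atMost-fibres _≟_ f ys rest (λ z u′ qs → fib z u′ (All.map (λ ((p , _) , eq) → p , eq) qs))
            (Unique.filter⁺ (¬? ∘ y?) u)
            (All.zip (All.filter⁺ (¬? ∘ y?) ps , All.all-filter (¬? ∘ y?) xs))) ⟩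
  n ℕ.+ length ys ℕ.* n                ∎
  where
  open ℕ.≤-Reasoning
  y? = λ x → f x ≟ y
  rest : ∀ {x} → P x × f x ≢ y → f x ∈ ys
  rest (p , fx≢y) with f∈ p
  ... | here eq = contradiction eq fx≢y
  ... | there i = i

atMost-1 : ∀ {A : Set} {P : A → Set} → (∀ {x y} → P x → P y → x ≡ y) → AtMost 1 P
atMost-1 eq {[]} u ps = z≤n
atMost-1 eq {x ∷ []} u ps = s≤s z≤n
atMost-1 eq {x ∷ y ∷ xs} ((x≢y ∷ _) ∷ _) (p ∷ q ∷ _) = contradiction (eq p q) x≢y

atMost-injective : ∀ {A B : Set} {P : A → Set} → DecidableEquality B → (f : A → B) (ys : List B) →
  (∀ {x} → P x → f x ∈ ys) →
  (∀ {x y} → P x → P y → f x ≡ f y → x ≡ y) →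
  AtMost (length ys) P
atMost-injective {P = P} _≟_ f ys f∈ inj u ps =
  ℕ.≤-trans (atMost-fibres {P = P} _≟_ f ys f∈ (λ y → atMost-1 λ (p , e) (q , e′) → inj p q (trans e (sym e′))) u ps)
            (ℕ.≤-reflexive (ℕ.*-identityʳ _))

-- The divisor bound

-- A cover rather than an enumeration: repetitions and non-divisors are allowed, as only upper
-- bounds on the length matter.
DivisorsIn : ℕ → List ℕ → Set
DivisorsIn N ds = ∀ {d} → d ℕ.∣ N → d ∈ ds

-- By Euclid's lemma a divisor prime to q already divides m; any other is q times a divisor for the
-- previous exponent. As covers may overlap, q may itself divide m, so repeated primes can be added
-- one at a time.
divisors-prime-^ : ∀ {q m ds} → Prime q → DivisorsIn m ds → ∀ e →
  Σ[ es ∈ List ℕ ] length es ≡ suc e ℕ.* length ds × DivisorsIn (q ℕ.^ e ℕ.* m) es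
divisors-prime-^ {q} {m} {ds} pq h zero =
  ds , sym (ℕ.+-identityʳ _) , λ d∣ → h (subst (_ ℕ.∣_) (ℕ.+-identityʳ m) d∣)
divisors-prime-^ {q} {m} {ds} pq h (suc e) with divisors-prime-^ {q} {m} pq h e
... | es , len , h′ =
  ds ++ map (q ℕ.*_) es
  , trans (length-++ ds) (cong (length ds ℕ.+_) (trans (length-map _ es) len))
  , cover
  where
  instance _ = prime⇒nonZero pq
  drop-q : ∀ {d} k → ¬ q ℕ.∣ d → d ℕ.∣ q ℕ.^ k ℕ.* m → d ℕ.∣ m
  drop-q {d} zero q∤d d∣ = subst (d ℕ.∣_) (ℕ.+-identityʳ m) d∣
  drop-q {d} (suc k) q∤d d∣qkm@(ℕ.divides c eq)
    with euclidsLemma c d pq (ℕ.divides (q ℕ.^ k ℕ.* m)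
           (trans (sym eq) (trans (ℕ.*-assoc q _ m) (ℕ.*-comm q _))))
  ... | inj₂ q∣d = contradiction q∣d q∤d
  ... | inj₁ (ℕ.divides c′ refl) = drop-q k q∤d (ℕ.divides c′ (ℕ.*-cancelˡ-≡ _ _ q
          (trans (sym (ℕ.*-assoc q _ m)) (trans eq (lem c′ q d)))))
    where
    lem : ∀ c q d → c ℕ.* q ℕ.* d ≡ q ℕ.* (c ℕ.* d)
    lem = ℕ-solver.solve-∀
  cover : DivisorsIn (q ℕ.^ suc e ℕ.* m) (ds ++ map (q ℕ.*_) es)
  cover {d} d∣ with q ℕ.∣? d
  ... | no q∤d = ∈-++⁺ˡ (h (drop-q (suc e) q∤d d∣))
  ... | yes (ℕ.divides d′ refl) = ∈-++⁺ʳ ds (subst (_∈ map (q ℕ.*_) es) (ℕ.*-comm q d′)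
          (∈-map⁺ (q ℕ.*_) (h′ (ℕ.*-cancelˡ-∣ {m = d′} {n = q ℕ.^ e ℕ.* m} q
            (subst (q ℕ.* d′ ℕ.∣_) (ℕ.*-assoc q (q ℕ.^ e) m) (subst (ℕ._∣ q ℕ.^ suc e ℕ.* m) (ℕ.*-comm d′ q) d∣))))))

^-distribʳ-* : ∀ k m n → (m ℕ.* n) ℕ.^ k ≡ m ℕ.^ k ℕ.* n ℕ.^ k
^-distribʳ-* zero    m n = refl
^-distribʳ-* (suc k) m n = trans (cong ((m ℕ.* n) ℕ.*_) (^-distribʳ-* k m n))
  (ℕ.[m*n]*[o*p]≡[m*o]*[n*p] m n (m ℕ.^ k) (n ℕ.^ k))

-- With q = floor (e / k), e + 1 ≤ k (q + 1) ≤ k 2 ^ q; the k-th power turns 2 ^ q into at most 2 ^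
-- e.
suc^≤ : ∀ k .{{_ : NonZero k}} e → suc e ℕ.^ k ≤ k ℕ.^ k ℕ.* 2 ℕ.^ e
suc^≤ k e = begin
  suc e ℕ.^ k                      ≤⟨ ℕ.^-monoˡ-≤ k e<k[1+q] ⟩
  (k ℕ.* suc q) ℕ.^ k              ≤⟨ ℕ.^-monoˡ-≤ k (ℕ.*-monoʳ-≤ k (1+n≤2^n q)) ⟩
  (k ℕ.* 2 ℕ.^ q) ℕ.^ k            ≡⟨ ^-distribʳ-* k k (2 ℕ.^ q) ⟩
  k ℕ.^ k ℕ.* (2 ℕ.^ q) ℕ.^ k      ≡⟨ cong (k ℕ.^ k ℕ.*_) (ℕ.^-*-assoc 2 q k) ⟩
  k ℕ.^ k ℕ.* 2 ℕ.^ (q ℕ.* k)      ≤⟨ ℕ.*-monoʳ-≤ (k ℕ.^ k) (ℕ.^-monoʳ-≤ 2 (ℕ.m/n*n≤m e k)) ⟩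
  k ℕ.^ k ℕ.* 2 ℕ.^ e              ∎
  where
  open ℕ.≤-Reasoning
  q = e ℕ./ k
  1+n≤2^n : ∀ n → suc n ≤ 2 ℕ.^ n
  1+n≤2^n zero    = s≤s z≤n
  1+n≤2^n (suc n) = ℕ.+-mono-≤ (ℕ.^-monoʳ-≤ 2 (z≤n {n})) (ℕ.≤-trans (1+n≤2^n n) (ℕ.m≤m+n _ 0))
  e<k[1+q] : suc e ≤ k ℕ.* suc q
  e<k[1+q] = begin
    suc e                              ≡⟨ cong suc (ℕ.m≡m%n+[m/n]*n e k) ⟩
    suc (e ℕ.% k) ℕ.+ q ℕ.* k          ≤⟨ ℕ.+-monoˡ-≤ (q ℕ.* k) (ℕ.m%n<n e k) ⟩
    suc q ℕ.* k                        ≡⟨ ℕ.*-comm (suc q) k ⟩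
    k ℕ.* suc q                        ∎

extract-power : ∀ q → 2 ≤ q → ∀ N → 1 ≤ N →
  ∃[ e ] ∃[ m ] N ≡ q ℕ.^ e ℕ.* m × ¬ q ℕ.∣ m
extract-power q 2≤q = <-rec _ step
  where
  step : ∀ N → (∀ {M} → M < N → 1 ≤ M → ∃[ e ] ∃[ m ] M ≡ q ℕ.^ e ℕ.* m × ¬ q ℕ.∣ m) →
         1 ≤ N → ∃[ e ] ∃[ m ] N ≡ q ℕ.^ e ℕ.* m × ¬ q ℕ.∣ m
  step N rec 1≤N with q ℕ.∣? N
  ... | no q∤N = 0 , N , sym (ℕ.+-identityʳ N) , q∤N
  ... | yes (ℕ.divides m@(suc _) refl) with rec (ℕ.m<m*n m q 2≤q) (s≤s z≤n)
  ...   | e , m′ , eq , q∤m′ = suc e , m′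
        , trans (cong (ℕ._* q) eq) (trans (ℕ.*-comm _ q) (sym (ℕ.*-assoc q (q ℕ.^ e) m′))) , q∤m′

DivisorBound : ℕ → ℕ → ℕ → Set
DivisorBound k C N = Σ[ ds ∈ List ℕ ] DivisorsIn N ds × length ds ℕ.^ k ≤ C ℕ.* N

divisorBound-large-primes : ∀ k {qs} → All (λ q → Prime q × 2 ℕ.^ k ≤ q) qs →
  DivisorBound k 1 (product qs)
divisorBound-large-primes k [] = 1 ∷ [] , (λ d∣1 → here (ℕ.∣1⇒≡1 d∣1)) , ℕ.≤-reflexive (ℕ.^-zeroˡ k)
divisorBound-large-primes k {q ∷ qs} ((pq , 2^k≤q) ∷ pqs)
  with divisorBound-large-primes k pqs
... | ds , h , len with divisors-prime-^ pq h 1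
... | es , eq , h′ = es
  , (λ {d} d∣ → h′ (subst (λ x → d ℕ.∣ x ℕ.* product qs) (sym (ℕ.^-identityʳ q)) d∣))
  , (begin
  length es ℕ.^ k                    ≡⟨ cong (ℕ._^ k) eq ⟩
  (2 ℕ.* length ds) ℕ.^ k            ≡⟨ ^-distribʳ-* k 2 (length ds) ⟩
  2 ℕ.^ k ℕ.* length ds ℕ.^ k        ≤⟨ ℕ.*-mono-≤ 2^k≤q (ℕ.≤-trans len (ℕ.≤-reflexive (ℕ.+-identityʳ _))) ⟩
  q ℕ.* product qs                   ≡⟨ sym (ℕ.+-identityʳ _) ⟩
  1 ℕ.* (q ℕ.* product qs)           ∎)
  where open ℕ.≤-Reasoning

-- Only the primes below 2 ^ k cost a constant, because (e + 1) ^ k ≤ k ^ k * q ^ e for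
-- every q ≥ 2; a prime q ≥ 2 ^ k pays for the factor 2 by itself.
divisorBound-rough : ∀ k .{{_ : NonZero k}} j {i} → 2 ≤ i → 2 ℕ.^ k ≤ i ℕ.+ j →
  ∀ N → 1 ≤ N → i Rough N → DivisorBound k ((k ℕ.^ k) ℕ.^ j) N
divisorBound-rough k zero {i} 2≤i 2^k≤i N 1≤N rough =
  subst (DivisorBound k 1) (sym isFactorisation)
    (divisorBound-large-primes k (All.tabulate λ {q} q∈ →
      let pq = All.lookup factorsPrime q∈
          instance _ = prime⇒nonTrivial pq
      in pq , ℕ.≤-trans (subst (2 ℕ.^ k ≤_) (ℕ.+-identityʳ i) 2^k≤i)
                (rough⇒≤ (rough∧∣⇒rough rough (subst (q ℕ.∣_) (sym isFactorisation) (∈⇒∣product q∈))))))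
  where
  instance _ = ℕ.>-nonZero 1≤N
  open PrimeFactorisation (factorise N)
divisorBound-rough k (suc j) {i} 2≤i 2^k≤i+1+j N 1≤N rough
  with extract-power i 2≤i N 1≤N
... | zero , m , refl , i∤m =
  let ds , h , len = divisorBound-rough k j {suc i} (ℕ.m≤n⇒m≤1+n 2≤i)
                       (subst (2 ℕ.^ k ≤_) (ℕ.+-suc i j) 2^k≤i+1+j) (m ℕ.+ 0) 1≤N
                       (∤⇒rough-suc (λ i∣ → i∤m (subst (i ℕ.∣_) (ℕ.+-identityʳ m) i∣)) rough)
  in ds , h , ℕ.≤-trans len (ℕ.*-monoˡ-≤ (m ℕ.+ 0) (ℕ.m≤n*m ((k ℕ.^ k) ℕ.^ j) (k ℕ.^ k)))
  where instance _ = ℕ.m^n≢0 k k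
-- An `i` dividing an `i`-rough number is prime. The sieve can thus run over all integers, composite
-- ones falling under exponent zero.
... | suc e′ , m , refl , i∤m =
  let e = suc e′
      C = (k ℕ.^ k) ℕ.^ j
      1≤m = ℕ.>-nonZero⁻¹ m {{ℕ.m*n≢0⇒n≢0 (i ℕ.^ e) {{ℕ.>-nonZero 1≤N}}}}
      ds , h , len = divisorBound-rough k j {suc i} (ℕ.m≤n⇒m≤1+n 2≤i)
                       (subst (2 ℕ.^ k ≤_) (ℕ.+-suc i j) 2^k≤i+1+j) m 1≤m
                       (∤⇒rough-suc i∤m (rough∧∣⇒rough rough (ℕ.n∣m*n (i ℕ.^ e))))
      es , eq , h′ = divisors-prime-^ {m = m} prime-i h e
  in es , h′ , (begin
    length es ℕ.^ k                                      ≡⟨ cong (ℕ._^ k) eq ⟩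
    (suc e ℕ.* length ds) ℕ.^ k                          ≡⟨ ^-distribʳ-* k (suc e) (length ds) ⟩
    suc e ℕ.^ k ℕ.* length ds ℕ.^ k                      ≤⟨ ℕ.*-mono-≤ (suc^≤ k e) len ⟩
    (k ℕ.^ k ℕ.* 2 ℕ.^ e) ℕ.* (C ℕ.* m)                  ≤⟨ ℕ.*-monoˡ-≤ (C ℕ.* m) (ℕ.*-monoʳ-≤ (k ℕ.^ k) (ℕ.^-monoˡ-≤ e 2≤i)) ⟩
    (k ℕ.^ k ℕ.* i ℕ.^ e) ℕ.* (C ℕ.* m)                  ≡⟨ ℕ.[m*n]*[o*p]≡[m*o]*[n*p] (k ℕ.^ k) (i ℕ.^ e) C m ⟩
    (k ℕ.^ k ℕ.* C) ℕ.* (i ℕ.^ e ℕ.* m)                  ∎)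
  where
  open ℕ.≤-Reasoning
  instance _ = ℕ.n>1⇒nonTrivial 2≤i
  prime-i : Prime i
  prime-i = rough∧∣⇒prime rough (ℕ.divides (i ℕ.^ e′ ℕ.* m)
              (trans (ℕ.*-assoc i _ m) (ℕ.*-comm i _)))

divisorBound : ∀ k .{{_ : NonZero k}} → Σ[ C ∈ ℕ ] 1 ≤ C × (∀ N → 1 ≤ N → DivisorBound k C N)
divisorBound k = (k ℕ.^ k) ℕ.^ (2 ℕ.^ k) , ℕ.>-nonZero⁻¹ _ {{ℕ.m^n≢0 (k ℕ.^ k) (2 ℕ.^ k) {{ℕ.m^n≢0 k k}}}} , λ N 1≤N →
  divisorBound-rough k (2 ℕ.^ k) (s≤s (s≤s z≤n)) (ℕ.m≤n+m _ 2) N 1≤N 2-rough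

-- Hyperbolas

*-≢0 : ∀ {i j} → i ≢ 0ℤ → j ≢ 0ℤ → i ℤ.* j ≢ 0ℤ
*-≢0 {i} i≢0 j≢0 ij≡0 = [ i≢0 , j≢0 ]′ (ℤ.i*j≡0⇒i≡0∨j≡0 i ij≡0)

-- The equation amounts to (r u + L)(r v + L) = r w + L². The factors must be nonzero, since a
-- degenerate hyperbola is a pair of lines, which can carry far more than M ^ o(1) points.
record OnHyperbola (r L w : ℤ) (M : ℕ) (uv : ℤ × ℤ) : Set where
  constructor onHyperbola
  private
    u = proj₁ uv
    v = proj₂ uv
  field
    equation : r ℤ.* (u ℤ.* v) ℤ.+ L ℤ.* (u ℤ.+ v) ≡ w
    u-factor : r ℤ.* u ℤ.+ L ≢ 0ℤ
    v-factor : r ℤ.* v ℤ.+ L ≢ 0ℤ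
    ∣u∣≤M    : ∣ u ∣ ≤ M
    ∣v∣≤M    : ∣ v ∣ ≤ M

-- When A ≠ 0, `u` is recovered from its affine image, so `length ks` bounds the number of values of
-- `u`.
AffineCover : ℤ → ℤ → List ℤ → List (ℤ × ℤ) → Set
AffineCover A B ks = All (λ (u , _) → A ℤ.* u ℤ.+ B ∈ ks)

abs-+≤ : ∀ {i j m n} → ∣ i ∣ ≤ m → ∣ j ∣ ≤ n → ∣ i ℤ.+ j ∣ ≤ m ℕ.+ n
abs-+≤ {i} {j} i≤m j≤n = ℕ.≤-trans (ℤ.∣i+j∣≤∣i∣+∣j∣ i j) (ℕ.+-mono-≤ i≤m j≤n)

abs--≤ : ∀ {i j m n} → ∣ i ∣ ≤ m → ∣ j ∣ ≤ n → ∣ i ℤ.- j ∣ ≤ m ℕ.+ n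
abs--≤ {i} {j} i≤m j≤n = ℕ.≤-trans (ℤ.∣i-j∣≤∣i∣+∣j∣ i j) (ℕ.+-mono-≤ i≤m j≤n)

abs-*≤ : ∀ {i j m n} → ∣ i ∣ ≤ m → ∣ j ∣ ≤ n → ∣ i ℤ.* j ∣ ≤ m ℕ.* n
abs-*≤ {i} {j} i≤m j≤n = ℕ.≤-trans (ℕ.≤-reflexive (ℤ.abs-* i j)) (ℕ.*-mono-≤ i≤m j≤n)

1≤∣i∣ : ∀ {i} → i ≢ 0ℤ → 1 ≤ ∣ i ∣
1≤∣i∣ {i} i≢0 = ℕ.n≢0⇒n>0 (i≢0 ∘ ℤ.∣i∣≡0⇒i≡0)

signed : List ℕ → List ℤ
signed ds = map +_ ds ++ map (ℤ.-_ ∘ +_) ds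

∈-signed : ∀ {i ds} → ∣ i ∣ ∈ ds → i ∈ signed ds
∈-signed {+ n}      i∈ = ∈-++⁺ˡ (∈-map⁺ +_ i∈)
∈-signed { -[1+ n ]} {ds} i∈ = ∈-++⁺ʳ (map +_ ds) (∈-map⁺ (ℤ.-_ ∘ +_) i∈)

length-signed : ∀ ds → length (signed ds) ≡ 2 ℕ.* length ds
length-signed ds = trans (length-++ (map +_ ds))
  (cong₂ ℕ._+_ (length-map _ ds) (trans (length-map _ ds) (sym (ℕ.+-identityʳ _))))

-- This is (6 M²)², written as |A| ≤ 4 M and |B| ≤ 2 M² produce it: |A u + B| ≤ 6 M².
36M⁴ : ∀ M → (((M ℕ.+ M) ℕ.+ (M ℕ.+ M)) ℕ.* M ℕ.+ (M ℕ.* M ℕ.+ M ℕ.* M)) ℕ.*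
             (((M ℕ.+ M) ℕ.+ (M ℕ.+ M)) ℕ.* M ℕ.+ (M ℕ.* M ℕ.+ M ℕ.* M)) ≡ 36 ℕ.* (M ℕ.* (M ℕ.* (M ℕ.* (M ℕ.* 1))))
36M⁴ = ℕ-solver.solve-∀

module _ {k C : ℕ} (bound : ∀ N → 1 ≤ N → DivisorBound k C N)
         {r L w : ℤ} (r≢0 : r ≢ 0ℤ) {M : ℕ} where

  private
    -- The equation is linear in X = u v and Y = u + v, so all differences of points have the same
    -- direction.
    slope : ∀ {u v u₀ v₀} → OnHyperbola r L w M (u , v) → OnHyperbola r L w M (u₀ , v₀) →
      r ℤ.* (u₀ ℤ.* v₀ ℤ.- u ℤ.* v) ≡ L ℤ.* ((u ℤ.+ v) ℤ.- (u₀ ℤ.+ v₀))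
    slope {u} {v} {u₀} {v₀} pt pt₀ = trans (difference r L u v u₀ v₀)
      (trans (cong (ℤ._+ L ℤ.* ((u ℤ.+ v) ℤ.- (u₀ ℤ.+ v₀)))
        (ℤ.i≡j⇒i-j≡0 (trans (equation pt₀) (sym (equation pt))))) (ℤ.+-identityˡ _))
      where
      open OnHyperbola
      difference : ∀ r L u v u₀ v₀ → r ℤ.* (u₀ ℤ.* v₀ ℤ.- u ℤ.* v) ≡
        (r ℤ.* (u₀ ℤ.* v₀) ℤ.+ L ℤ.* (u₀ ℤ.+ v₀)) ℤ.- (r ℤ.* (u ℤ.* v) ℤ.+ L ℤ.* (u ℤ.+ v))
          ℤ.+ L ℤ.* ((u ℤ.+ v) ℤ.- (u₀ ℤ.+ v₀))
      difference = ℤ-solver.solve-∀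

    -- Equal sums force equal products, as r ≠ 0; then u is a root of the quadratic with roots u₀
    -- and v₀.
    cover-same-sum : ∀ {u₀ v₀ zs} → OnHyperbola r L w M (u₀ , v₀) →
      All (λ (u , v) → u ℤ.+ v ≡ u₀ ℤ.+ v₀) zs → All (OnHyperbola r L w M) zs →
      AffineCover (+ 1) 0ℤ (u₀ ∷ v₀ ∷ []) zs
    cover-same-sum {u₀} {v₀} pt₀ sames pts =
      All.zipWith (λ {uv} → root {uv}) (sames , pts)
      where
      factor : ∀ u v u₀ v₀ → (u ℤ.- u₀) ℤ.* (u ℤ.- v₀) ≡
        (u₀ ℤ.* v₀ ℤ.- u ℤ.* v) ℤ.+ u ℤ.* ((u ℤ.+ v) ℤ.- (u₀ ℤ.+ v₀))
      factor = ℤ-solver.solve-∀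
      root : ∀ {uv} → (proj₁ uv ℤ.+ proj₂ uv ≡ u₀ ℤ.+ v₀) × OnHyperbola r L w M uv →
             + 1 ℤ.* proj₁ uv ℤ.+ 0ℤ ∈ u₀ ∷ v₀ ∷ []
      root {u , v} (same , pt) =
        subst (_∈ u₀ ∷ v₀ ∷ []) (sym (trans (ℤ.+-identityʳ _) (ℤ.*-identityˡ u)))
          ([ (λ e → here (ℤ.i-j≡0⇒i≡j u u₀ e)) , (λ e → there (here (ℤ.i-j≡0⇒i≡j u v₀ e))) ]′
            (ℤ.i*j≡0⇒i≡0∨j≡0 (u ℤ.- u₀) product≡0))
        where
        sum-diff : (u ℤ.+ v) ℤ.- (u₀ ℤ.+ v₀) ≡ 0ℤ
        sum-diff = ℤ.i≡j⇒i-j≡0 same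
        r*diff≡0 : r ℤ.* (u₀ ℤ.* v₀ ℤ.- u ℤ.* v) ≡ 0ℤ
        r*diff≡0 = trans (slope pt pt₀) (trans (cong (L ℤ.*_) sum-diff) (ℤ.*-zeroʳ L))
        diff≡0 : u₀ ℤ.* v₀ ℤ.- u ℤ.* v ≡ 0ℤ
        diff≡0 = [ (λ r≡0 → contradiction r≡0 r≢0) , id ]′ (ℤ.i*j≡0⇒i≡0∨j≡0 r r*diff≡0)
        product≡0 : (u ℤ.- u₀) ℤ.* (u ℤ.- v₀) ≡ 0ℤ
        product≡0 = trans (factor u v u₀ v₀)
          (cong₂ ℤ._+_ diff≡0 (trans (cong (u ℤ.*_) sum-diff) (ℤ.*-zeroʳ u)))

    module DistinctSums {u₀ v₀ u₁ v₁ : ℤ} (pt₀ : OnHyperbola r L w M (u₀ , v₀))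
      (pt₁ : OnHyperbola r L w M (u₁ , v₁)) (Y₁≢Y₀ : u₁ ℤ.+ v₁ ≢ u₀ ℤ.+ v₀) where

      open OnHyperbola

      -- `slope` gives r B = L A: the fraction B / A equals L / r, but is built from coordinates of
      -- size at most M. Hence A (r u + L) = r (A u + B), which carries nonvanishing over to the new
      -- factors.
      A B N : ℤ
      A = (u₁ ℤ.+ v₁) ℤ.- (u₀ ℤ.+ v₀)
      B = u₀ ℤ.* v₀ ℤ.- u₁ ℤ.* v₁
      N = (A ℤ.* u₀ ℤ.+ B) ℤ.* (A ℤ.* v₀ ℤ.+ B)

      A≢0 : A ≢ 0ℤ
      A≢0 A≡0 = Y₁≢Y₀ (ℤ.i-j≡0⇒i≡j _ _ A≡0)

      scaled : ∀ {u} → r ℤ.* u ℤ.+ L ≢ 0ℤ → A ℤ.* u ℤ.+ B ≢ 0ℤ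
      scaled {u} f e = *-≢0 A≢0 f (trans (trans (distrib A r u L)
         (cong (ℤ._+_ (r ℤ.* (A ℤ.* u))) (sym (slope pt₁ pt₀))))
         (trans (sym (ℤ.*-distribˡ-+ r (A ℤ.* u) B)) (trans (cong (r ℤ.*_) e) (ℤ.*-zeroʳ r))))
        where
        distrib : ∀ A r u L → A ℤ.* (r ℤ.* u ℤ.+ L) ≡ r ℤ.* (A ℤ.* u) ℤ.+ L ℤ.* A
        distrib = ℤ-solver.solve-∀

      N≢0 : N ≢ 0ℤ
      N≢0 = *-≢0 (scaled (u-factor pt₀)) (scaled (v-factor pt₀))

      ∣N∣≤ : ∣ N ∣ ≤ 36 ℕ.* M ℕ.^ 4
      ∣N∣≤ = ℕ.≤-trans (abs-*≤ {A ℤ.* u₀ ℤ.+ B} {A ℤ.* v₀ ℤ.+ B} (affine (∣u∣≤M pt₀)) (affine (∣v∣≤M pt₀)))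
               (ℕ.≤-reflexive (36M⁴ M))
        where
        affine : ∀ {u} → ∣ u ∣ ≤ M → ∣ A ℤ.* u ℤ.+ B ∣ ≤ ((M ℕ.+ M) ℕ.+ (M ℕ.+ M)) ℕ.* M ℕ.+ (M ℕ.* M ℕ.+ M ℕ.* M)
        affine {u} b = abs-+≤ {A ℤ.* u} {B} (abs-*≤ {A} {u} (abs--≤ {u₁ ℤ.+ v₁} {u₀ ℤ.+ v₀}
            (abs-+≤ {u₁} {v₁} (∣u∣≤M pt₁) (∣v∣≤M pt₁)) (abs-+≤ {u₀} {v₀} (∣u∣≤M pt₀) (∣v∣≤M pt₀))) b)
          (abs--≤ {u₀ ℤ.* v₀} {u₁ ℤ.* v₁} (abs-*≤ {u₀} {v₀} (∣u∣≤M pt₀) (∣v∣≤M pt₀)) (abs-*≤ {u₁} {v₁} (∣u∣≤M pt₁) (∣v∣≤M pt₁)))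

      -- The product is A (A X + B Y) + B², so its difference from N is A times a form that vanishes
      -- on the line. The vanishing is checked after multiplication by r, where `slope` applies to
      -- both terms.
      factors : ∀ {u v} → OnHyperbola r L w M (u , v) → (A ℤ.* u ℤ.+ B) ℤ.* (A ℤ.* v ℤ.+ B) ≡ N
      factors {u} {v} pt = trans (lem A B u v u₀ v₀) (trans (cong (λ x → N ℤ.+ A ℤ.* x) line) (trans (cong (ℤ._+_ N) (ℤ.*-zeroʳ A)) (ℤ.+-identityʳ N)))
        where
        lem : ∀ A B u v u₀ v₀ → (A ℤ.* u ℤ.+ B) ℤ.* (A ℤ.* v ℤ.+ B) ≡
          (A ℤ.* u₀ ℤ.+ B) ℤ.* (A ℤ.* v₀ ℤ.+ B)
            ℤ.+ A ℤ.* (B ℤ.* ((u ℤ.+ v) ℤ.- (u₀ ℤ.+ v₀)) ℤ.- A ℤ.* (u₀ ℤ.* v₀ ℤ.- u ℤ.* v))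
        lem = ℤ-solver.solve-∀
        lem₂ : ∀ r L A B X Y → r ℤ.* (B ℤ.* Y ℤ.- A ℤ.* X) ≡ (r ℤ.* B) ℤ.* Y ℤ.- A ℤ.* (r ℤ.* X)
        lem₂ = ℤ-solver.solve-∀
        lem₃ : ∀ L A Y → (L ℤ.* A) ℤ.* Y ℤ.- A ℤ.* (L ℤ.* Y) ≡ 0ℤ
        lem₃ = ℤ-solver.solve-∀
        line : B ℤ.* ((u ℤ.+ v) ℤ.- (u₀ ℤ.+ v₀)) ℤ.- A ℤ.* (u₀ ℤ.* v₀ ℤ.- u ℤ.* v) ≡ 0ℤ
        line = [ (λ r≡0 → contradiction r≡0 r≢0) , id ]′ (ℤ.i*j≡0⇒i≡0∨j≡0 r
          (trans (lem₂ r L A B (u₀ ℤ.* v₀ ℤ.- u ℤ.* v) ((u ℤ.+ v) ℤ.- (u₀ ℤ.+ v₀)))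
          (trans (cong₂ (λ a b → a ℤ.* ((u ℤ.+ v) ℤ.- (u₀ ℤ.+ v₀)) ℤ.- A ℤ.* b) (slope pt₁ pt₀) (slope pt pt₀))
                 (lem₃ L A ((u ℤ.+ v) ℤ.- (u₀ ℤ.+ v₀))))))

      cover : ∀ {ds zs} → DivisorsIn ∣ N ∣ ds → All (OnHyperbola r L w M) zs → AffineCover A B (signed ds) zs
      cover h = All.map (λ {uv} pt → ∈-signed {A ℤ.* proj₁ uv ℤ.+ B} (h (ℕ.divides ∣ A ℤ.* proj₂ uv ℤ.+ B ∣
        (trans (cong ∣_∣ (sym (factors pt))) (trans (ℤ.abs-* (A ℤ.* proj₁ uv ℤ.+ B) (A ℤ.* proj₂ uv ℤ.+ B)) (ℕ.*-comm ∣ A ℤ.* proj₁ uv ℤ.+ B ∣ _))))))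

  -- All points of the fibre lie on one line A X + B Y = const in the coordinates X = u v,
  -- Y = u + v, whose coefficients (unlike r and L) are polynomially bounded in M; on it
  -- (A u + B) (A v + B) is a constant N, so that A u + B is a divisor of N.
  hyperbola-cover : 1 ≤ C → 1 ≤ M → ∀ {zs} → All (OnHyperbola r L w M) zs →
    Σ[ A ∈ ℤ ] Σ[ B ∈ ℤ ] Σ[ ks ∈ List ℤ ] A ≢ 0ℤ × AffineCover A B ks zs ×
      length ks ℕ.^ k ≤ 2 ℕ.^ k ℕ.* (C ℕ.* (36 ℕ.* M ℕ.^ 4))
  hyperbola-cover 1≤C 1≤M = go
    where
    instance _ = ℕ.m*n≢0 C (36 ℕ.* M ℕ.^ 4) {{ℕ.>-nonZero 1≤C}}
                   {{ℕ.m*n≢0 36 (M ℕ.^ 4) {{_}} {{ℕ.m^n≢0 M 4 {{ℕ.>-nonZero 1≤M}}}}}}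
    2^k≤ : 2 ℕ.^ k ≤ 2 ℕ.^ k ℕ.* (C ℕ.* (36 ℕ.* M ℕ.^ 4))
    2^k≤ = ℕ.m≤m*n (2 ℕ.^ k) (C ℕ.* (36 ℕ.* M ℕ.^ 4))
    go : ∀ {zs} → All (OnHyperbola r L w M) zs →
      Σ[ A ∈ ℤ ] Σ[ B ∈ ℤ ] Σ[ ks ∈ List ℤ ] A ≢ 0ℤ × AffineCover A B ks zs ×
      length ks ℕ.^ k ≤ 2 ℕ.^ k ℕ.* (C ℕ.* (36 ℕ.* M ℕ.^ 4))
    go [] = + 1 , 0ℤ , [] , (λ ()) , [] , ℕ.≤-trans (ℕ.^-monoˡ-≤ k (z≤n {2})) 2^k≤
    go {(u₀ , v₀) ∷ zs} (pt₀ ∷ pts)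
      with All.all? (λ (u , v) → u ℤ.+ v ℤ.≟ u₀ ℤ.+ v₀) zs
    ... | yes sames = + 1 , 0ℤ , u₀ ∷ v₀ ∷ [] , (λ ()) , cover-same-sum pt₀ (refl ∷ sames) (pt₀ ∷ pts) , 2^k≤
    ... | no ¬sames with find (All.¬All⇒Any¬ (λ (u , v) → u ℤ.+ v ℤ.≟ u₀ ℤ.+ v₀) zs ¬sames)
    ...   | (u₁ , v₁) , uv₁∈ , Y₁≢Y₀ =
      let open DistinctSums pt₀ (All.lookup pts uv₁∈) Y₁≢Y₀
          ds , h , len = bound ∣ N ∣ (1≤∣i∣ N≢0)
      in A , B , signed ds , A≢0 , cover h (pt₀ ∷ pts) , (begin
        length (signed ds) ℕ.^ k                     ≡⟨ cong (ℕ._^ k) (length-signed ds) ⟩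
        (2 ℕ.* length ds) ℕ.^ k                      ≡⟨ ^-distribʳ-* k 2 (length ds) ⟩
        2 ℕ.^ k ℕ.* length ds ℕ.^ k                  ≤⟨ ℕ.*-monoʳ-≤ (2 ℕ.^ k) (ℕ.≤-trans len (ℕ.*-monoʳ-≤ C ∣N∣≤)) ⟩
        2 ℕ.^ k ℕ.* (C ℕ.* (36 ℕ.* M ℕ.^ 4))         ∎)
      where open ℕ.≤-Reasoning

-- Congruences

∣+m-+n∣<o : ∀ {m n o} → m < o → n < o → ∣ + m ℤ.- + n ∣ < o
∣+m-+n∣<o {m} {n} m<o n<o = ℕ.≤-<-trans
  (subst (λ i → ∣ i ∣ ≤ m ℕ.⊔ n) (sym (ℤ.m-n≡m⊖n m n)) (ℤ.∣m⊝n∣≤m⊔n m n)) (ℕ.⊔-pres-<m m<o n<o)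

/-≡⇒∣-∣< : ∀ {m n} o .{{_ : NonZero o}} → m ℕ./ o ≡ n ℕ./ o → ∣ + m ℤ.- + n ∣ < o
/-≡⇒∣-∣< {m} {n} o eq = subst (λ i → ∣ i ∣ < o) (sym same) (∣+m-+n∣<o (ℕ.m%n<n m o) (ℕ.m%n<n n o))
  where
  division : ∀ m → + m ≡ + (m ℕ.% o) ℤ.+ + (m ℕ./ o) ℤ.* + o
  division m = ℤ.a≡a%ℕn+[a/ℕn]*n (+ m) o
  cancel : ∀ a b c → (a ℤ.+ c) ℤ.- (b ℤ.+ c) ≡ a ℤ.- b
  cancel = ℤ-solver.solve-∀
  same : + m ℤ.- + n ≡ + (m ℕ.% o) ℤ.- + (n ℕ.% o)
  same = trans (cong₂ ℤ._-_ (division m) (trans (division n) (cong (λ q → + (n ℕ.% o) ℤ.+ + q ℤ.* + o) (sym eq))))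
    (cancel (+ (m ℕ.% o)) (+ (n ℕ.% o)) (+ (m ℕ./ o) ℤ.* + o))

-- Dirichlet's approximation by pigeonhole: the R + 1 residues of j L for 0 ≤ j ≤ R fall into R bins
-- of width p / R, and two in the same bin are subtracted.
dirichlet : ∀ p R .{{_ : NonZero p}} .{{_ : NonZero R}} (L : ℤ) →
  Σ[ r ∈ ℕ ] Σ[ L₀ ∈ ℤ ] Σ[ h ∈ ℤ ] 1 ≤ r × r ≤ R × + r ℤ.* L ≡ L₀ ℤ.+ h ℤ.* + p × R ℕ.* ∣ L₀ ∣ < p
dirichlet p R L with Fin.pigeonhole (ℕ.n<1+n R) bin
  where
  residue : ℕ → ℕ
  residue j = (+ j ℤ.* L) ℤ.%ℕ p
  bin : Fin (suc R) → Fin R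
  bin j = fromℕ< {(R ℕ.* residue (toℕ j)) ℕ./ p} (ℕ.m<n*o⇒m/o<n (ℕ.*-monoʳ-< R (ℤ.n%ℕd<d (+ toℕ j ℤ.* L) p)))
... | i , j , i<j , eq =
  toℕ j ℕ.∸ toℕ i , + x j ℤ.- + x i , h j ℤ.- h i
  , ℕ.m<n⇒0<n∸m i<j
  , ℕ.≤-trans (ℕ.m∸n≤m (toℕ j) (toℕ i)) (ℕ.s≤s⁻¹ (Fin.toℕ<n j))
  , trans (cong (ℤ._* L) (trans (sym (ℤ.⊖-≥ (ℕ.<⇒≤ i<j))) (sym (ℤ.m-n≡m⊖n (toℕ j) (toℕ i)))))
    (trans (ℤ.*-distribʳ-+ L (+ toℕ j) (ℤ.- + toℕ i))
    (trans (cong (ℤ._+_ (+ toℕ j ℤ.* L)) (sym (ℤ.neg-distribˡ-* (+ toℕ i) L)))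
    (trans (cong₂ ℤ._-_ (division j) (division i)) (regroup (+ x j) (h j) (+ x i) (h i) (+ p)))))
  , subst (_< p) (trans (cong ∣_∣ scale) (ℤ.abs-* (+ R) (+ x j ℤ.- + x i)))
      (/-≡⇒∣-∣< p (sym (trans (sym (Fin.toℕ-fromℕ< _)) (trans (cong toℕ eq) (Fin.toℕ-fromℕ< _)))))
  where
  x : Fin (suc R) → ℕ
  x j = (+ toℕ j ℤ.* L) ℤ.%ℕ p
  h : Fin (suc R) → ℤ
  h j = (+ toℕ j ℤ.* L) ℤ./ℕ p
  division : ∀ j → + toℕ j ℤ.* L ≡ + x j ℤ.+ h j ℤ.* + p
  division j = ℤ.a≡a%ℕn+[a/ℕn]*n (+ toℕ j ℤ.* L) p
  regroup : ∀ a b c d p → (a ℤ.+ b ℤ.* p) ℤ.- (c ℤ.+ d ℤ.* p) ≡ (a ℤ.- c) ℤ.+ (b ℤ.- d) ℤ.* p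
  regroup = ℤ-solver.solve-∀
  distrib : ∀ a b c → a ℤ.* b ℤ.- a ℤ.* c ≡ a ℤ.* (b ℤ.- c)
  distrib = ℤ-solver.solve-∀
  scale : + (R ℕ.* x j) ℤ.- + (R ℕ.* x i) ≡ + R ℤ.* (+ x j ℤ.- + x i)
  scale = trans (cong₂ ℤ._-_ (ℤ.pos-* R (x j)) (ℤ.pos-* R (x i))) (distrib (+ R) (+ x j) (+ x i))

euclidsLemmaℤ : ∀ {p} → Prime p → ∀ a {b} → + p ℤ.∣ a ℤ.* b → + p ℤ.∣ a ⊎ + p ℤ.∣ b
euclidsLemmaℤ pp a {b} p∣ab =
  [ inj₁ ∘ ℤ.∣ᵤ⇒∣ , inj₂ ∘ ℤ.∣ᵤ⇒∣ ]′
    (euclidsLemma ∣ a ∣ ∣ b ∣ pp (subst (_ ℕ.∣_) (ℤ.abs-* a b) (ℤ.∣⇒∣ᵤ p∣ab)))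

∣∧∣-∣<⇒≡ : ∀ {p i j} → + p ℤ.∣ i ℤ.- j → ∣ i ℤ.- j ∣ < p → i ≡ j
∣∧∣-∣<⇒≡ {p} {i} {j} p∣ <p with ∣ i ℤ.- j ∣ in eq
... | zero = ℤ.i-j≡0⇒i≡j i j (ℤ.∣i∣≡0⇒i≡0 eq)
... | suc n = contradiction (subst (p ℕ.∣_) eq (ℤ.∣⇒∣ᵤ p∣)) (ℕ.>⇒∤ <p)

∤-^ : ∀ {p x} → Prime p → ¬ + p ℤ.∣ x → ∀ n → ¬ + p ℤ.∣ x ℤ.^ n
∤-^ pp p∤x zero p∣1 = contradiction (ℕ.∣1⇒≡1 (ℤ.∣⇒∣ᵤ p∣1)) λ { refl → case pp of λ () }
∤-^ {x = x} pp p∤x (suc n) p∣ = [ p∤x , ∤-^ pp p∤x n ]′ (euclidsLemmaℤ pp x p∣)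

module Powers {p g : ℕ} (pp : Prime p) (p∤g : ¬ + p ℤ.∣ + g) where

  p∤g^ : ∀ n → ¬ + p ℤ.∣ (+ g) ℤ.^ n
  p∤g^ = ∤-^ pp p∤g

  module _ {t : ℕ} (order : IsMultiplicativeOrder p g t) where
    open IsMultiplicativeOrder order

    order≤difference : ∀ {i j} → i < j → + p ℤ.∣ (+ g) ℤ.^ j ℤ.- (+ g) ℤ.^ i → t ≤ j ℕ.∸ i
    order≤difference {i} {j} i<j p∣ = minimal (j ℕ.∸ i) (ℕ.m<n⇒0<n∸m i<j)
      ([ (λ p∣g^i → contradiction p∣g^i (p∤g^ i)) , id ]′ (euclidsLemmaℤ pp ((+ g) ℤ.^ i) (subst (+ p ℤ.∣_) eq p∣)))
      where
      distrib : ∀ a b → a ℤ.* b ℤ.- a ≡ a ℤ.* (b ℤ.- + 1)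
      distrib = ℤ-solver.solve-∀
      eq : (+ g) ℤ.^ j ℤ.- (+ g) ℤ.^ i ≡ (+ g) ℤ.^ i ℤ.* ((+ g) ℤ.^ (j ℕ.∸ i) ℤ.- + 1)
      eq = trans (cong (λ n → (+ g) ℤ.^ n ℤ.- (+ g) ℤ.^ i) (sym (ℕ.m+[n∸m]≡n (ℕ.<⇒≤ i<j))))
        (trans (cong (ℤ._- (+ g) ℤ.^ i) (ℤ.^-distribˡ-+-* (+ g) i (j ℕ.∸ i))) (distrib ((+ g) ℤ.^ i) _))

    power-injective : ∀ {i j} → i < t → j < t → + p ℤ.∣ (+ g) ℤ.^ i ℤ.- (+ g) ℤ.^ j → i ≡ j
    power-injective {i} {j} i<t j<t p∣ with ℕ.<-cmp i j
    ... | tri≈ _ i≡j _ = i≡j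
    ... | tri> _ _ j<i = contradiction (ℕ.≤-trans (order≤difference j<i p∣) (ℕ.m∸n≤m i j)) (ℕ.<⇒≱ i<t)
    ... | tri< i<j _ _ = contradiction (ℕ.≤-trans (order≤difference i<j
            (subst (+ p ℤ.∣_) (neg-sub ((+ g) ℤ.^ i) ((+ g) ℤ.^ j)) (ℤ.∣m⇒∣-m p∣))) (ℕ.m∸n≤m j i)) (ℕ.<⇒≱ j<t)
      where
      neg-sub : ∀ a b → ℤ.- (a ℤ.- b) ≡ b ℤ.- a
      neg-sub = ℤ-solver.solve-∀

    -- Pigeonhole on g ^ 0, ..., g ^ p. It serves to derive M < p from M < t, so that the Dirichlet
    -- parameter R is positive.
    order≤p : t ≤ p
    order≤p with Fin.pigeonhole (ℕ.n<1+n p) residue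
      where
      instance _ = prime⇒nonZero pp
      residue : Fin (suc p) → Fin p
      residue j = fromℕ< (ℤ.n%ℕd<d ((+ g) ℤ.^ toℕ j) p)
    ... | i , j , i<j , eq = ℕ.≤-trans (order≤difference i<j
        (subst (+ p ℤ.∣_) (sym same) (ℤ.∣n⇒∣m*n (h (toℕ j) ℤ.- h (toℕ i)) ℤ.∣-refl)))
        (ℕ.≤-trans (ℕ.m∸n≤m (toℕ j) (toℕ i)) (ℕ.s≤s⁻¹ (Fin.toℕ<n j)))
      where
      instance _ = prime⇒nonZero pp
      x : ℕ → ℕ
      x n = ((+ g) ℤ.^ n) ℤ.%ℕ p
      h : ℕ → ℤ
      h n = ((+ g) ℤ.^ n) ℤ./ℕ p
      division : ∀ n → (+ g) ℤ.^ n ≡ + x n ℤ.+ h n ℤ.* + p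
      division n = ℤ.a≡a%ℕn+[a/ℕn]*n ((+ g) ℤ.^ n) p
      cancel : ∀ a b c p → (a ℤ.+ b ℤ.* p) ℤ.- (a ℤ.+ c ℤ.* p) ≡ (b ℤ.- c) ℤ.* p
      cancel = ℤ-solver.solve-∀
      same : (+ g) ℤ.^ toℕ j ℤ.- (+ g) ℤ.^ toℕ i ≡ (h (toℕ j) ℤ.- h (toℕ i)) ℤ.* + p
      same = trans (cong₂ ℤ._-_ (division (toℕ j)) (trans (division (toℕ i)) (cong (λ y → + y ℤ.+ h (toℕ i) ℤ.* + p)
          (trans (sym (Fin.toℕ-fromℕ< _)) (trans (cong toℕ eq) (Fin.toℕ-fromℕ< _))))))
        (cancel (+ x (toℕ j)) (h (toℕ j)) (h (toℕ i)) (+ p))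

-- Points on the exponential curve

length-cartesianProduct : ∀ {A B : Set} (xs : List A) (ys : List B) →
  length (cartesianProduct xs ys) ≡ length xs ℕ.* length ys
length-cartesianProduct []       ys = refl
length-cartesianProduct (x ∷ xs) ys = trans (length-++ (map (x ,_) ys))
  (cong₂ ℕ._+_ (length-map (x ,_) ys) (length-cartesianProduct xs ys))

atMost-square : ∀ {A : Set} {P : A → Set} {n} → AtMost n (λ (x , y) → P x × P y) →
  ∀ {xs} → Unique xs → All P xs → length xs ℕ.* length xs ≤ n
atMost-square most {xs} u ps = subst (_≤ _) (length-cartesianProduct xs xs)
  (most (Unique.cartesianProduct⁺ u u)
        (All.tabulate λ xy∈ → let x∈ , y∈ = ∈-cartesianProduct⁻ xs xs xy∈
                              in All.lookup ps x∈ , All.lookup ps y∈))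

module Points
  {p g t : ℕ} (pp : Prime p) (p∤g : ¬ + p ℤ.∣ + g) (order : IsMultiplicativeOrder p g t)
  {M : ℕ} (1≤M : 1 ≤ M) (M<t : M < t) (c : ℤ) (p∤c : ¬ + p ℤ.∣ c) (L : ℤ)
  where

  open Powers pp p∤g

  private
    instance _ = prime⇒nonZero pp

  -- Coordinates are offsets: `c` will absorb a g ^ (K + 1), so that only natural exponents occur,
  -- and the ordinate is L + y.
  record Point (xy : ℕ × ℕ) : Set where
    constructor point
    field
      x<M        : proj₁ xy < M
      y≤M        : proj₂ xy ≤ M
      congruence : L ℤ.+ + proj₂ xy ≡ c ℤ.* (+ g) ℤ.^ proj₁ xy [mod p ]
  open Point

  private
    p∤y : ∀ {x y} → Point (x , y) → ¬ + p ℤ.∣ L ℤ.+ + y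
    p∤y {x} {y} pt p∣y = [ p∤c , p∤g^ x ]′ (euclidsLemmaℤ pp c
      (subst (+ p ℤ.∣_) (lem (L ℤ.+ + y) (c ℤ.* (+ g) ℤ.^ x)) (ℤ.∣m∣n⇒∣m-n p∣y (congruence pt))))
      where
      lem : ∀ a b → a ℤ.- (a ℤ.- b) ≡ b
      lem = ℤ-solver.solve-∀

    x-unique : ∀ {x x′ y} → Point (x , y) → Point (x′ , y) → x ≡ x′
    x-unique {x} {x′} {y} pt pt′ = power-injective order
      (ℕ.<-trans (x<M pt) M<t) (ℕ.<-trans (x<M pt′) M<t)
      ([ (λ p∣c → contradiction p∣c p∤c) , id ]′ (euclidsLemmaℤ pp c
        (subst (+ p ℤ.∣_) (lem (L ℤ.+ + y) c ((+ g) ℤ.^ x) ((+ g) ℤ.^ x′))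
          (ℤ.∣m∣n⇒∣m-n (congruence pt′) (congruence pt)))))
      where
      lem : ∀ a c b b′ → (a ℤ.- c ℤ.* b′) ℤ.- (a ℤ.- c ℤ.* b) ≡ c ℤ.* (b ℤ.- b′)
      lem = ℤ-solver.solve-∀

    product-congruence : ∀ {x₁ y₁ x₂ y₂} → Point (x₁ , y₁) → Point (x₂ , y₂) →
      + p ℤ.∣ (L ℤ.+ + y₁) ℤ.* (L ℤ.+ + y₂) ℤ.- c ℤ.* c ℤ.* (+ g) ℤ.^ (x₁ ℕ.+ x₂)
    product-congruence {x₁} {y₁} {x₂} {y₂} pt₁ pt₂ = subst (+ p ℤ.∣_)
      (trans (lem (L ℤ.+ + y₁) (L ℤ.+ + y₂) c ((+ g) ℤ.^ x₁) ((+ g) ℤ.^ x₂))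
        (cong (λ z → (L ℤ.+ + y₁) ℤ.* (L ℤ.+ + y₂) ℤ.- c ℤ.* c ℤ.* z) (sym (ℤ.^-distribˡ-+-* (+ g) x₁ x₂))))
      (ℤ.∣m∣n⇒∣m+n (ℤ.∣n⇒∣m*n (L ℤ.+ + y₁) (congruence pt₂))
                   (ℤ.∣n⇒∣m*n (c ℤ.* (+ g) ℤ.^ x₂) (congruence pt₁)))
      where
      lem : ∀ a b c u v → a ℤ.* (b ℤ.- c ℤ.* v) ℤ.+ c ℤ.* v ℤ.* (a ℤ.- c ℤ.* u) ≡ a ℤ.* b ℤ.- c ℤ.* c ℤ.* (u ℤ.* v)
      lem = ℤ-solver.solve-∀

  module Reduced
    {r R : ℕ} {L₀ h : ℤ} (1≤r : 1 ≤ r) (r≤R : r ≤ R) (r<p : r < p)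
    (rL≡ : + r ℤ.* L ≡ L₀ ℤ.+ h ℤ.* + p) (R∣L₀∣<p : R ℕ.* ∣ L₀ ∣ < p) (R²M≤p : R ℕ.* R ℕ.* M ≤ p)
    {Q : ℕ} (3M<QR : 3 ℕ.* M < Q ℕ.* R)
    {k C D : ℕ} (1≤C : 1 ≤ C) (bound : ∀ N → 1 ≤ N → DivisorBound k C N)
    (≤D : ∀ f → f ℕ.^ k ≤ 2 ℕ.^ k ℕ.* (C ℕ.* (36 ℕ.* M ℕ.^ 4)) → f ≤ D)
    where

    private
      instance
        _ = ℕ.>-nonZero (ℕ.<-≤-trans 1≤r r≤R)

      Pair : Set
      Pair = (ℕ × ℕ) × (ℕ × ℕ)

      Points : Pair → Set
      Points (P₁ , P₂) = Point P₁ × Point P₂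

      w : Pair → ℤ
      w ((_ , y₁) , (_ , y₂)) = + r ℤ.* (+ y₁ ℤ.* + y₂) ℤ.+ L₀ ℤ.* (+ y₁ ℤ.+ + y₂)

      -- After multiplication by R both terms are multiples of p M: R² M ≤ p controls r y₁ y₂, and R
      -- |L₀| < p controls the linear term. They add up to 3 M p.
      ∣w∣<Qp : ∀ {e} → Points e → ∣ w e ∣ < Q ℕ.* p
      ∣w∣<Qp {(_ , y₁) , (_ , y₂)} (pt₁ , pt₂) = ℕ.*-cancelˡ-< R _ _ (begin-strict
        R ℕ.* ∣ w ((0 , y₁) , (0 , y₂)) ∣
          ≤⟨ ℕ.*-monoʳ-≤ R (abs-+≤ {+ r ℤ.* (+ y₁ ℤ.* + y₂)} {L₀ ℤ.* (+ y₁ ℤ.+ + y₂)}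
               (abs-*≤ {+ r} {+ y₁ ℤ.* + y₂} r≤R (abs-*≤ {+ y₁} {+ y₂} (y≤M pt₁) (y≤M pt₂)))
               (abs-*≤ {L₀} {+ y₁ ℤ.+ + y₂} ℕ.≤-refl (abs-+≤ {+ y₁} {+ y₂} (y≤M pt₁) (y≤M pt₂)))) ⟩
        R ℕ.* (R ℕ.* (M ℕ.* M) ℕ.+ ∣ L₀ ∣ ℕ.* (M ℕ.+ M))
          ≡⟨ expand R M ∣ L₀ ∣ ⟩
        (R ℕ.* R ℕ.* M) ℕ.* M ℕ.+ (R ℕ.* ∣ L₀ ∣) ℕ.* (M ℕ.+ M)
          ≤⟨ ℕ.+-mono-≤ (ℕ.*-monoˡ-≤ M R²M≤p) (ℕ.*-monoˡ-≤ (M ℕ.+ M) (ℕ.<⇒≤ R∣L₀∣<p)) ⟩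
        p ℕ.* M ℕ.+ p ℕ.* (M ℕ.+ M)
          ≡⟨ collect p M ⟩
        (3 ℕ.* M) ℕ.* p
          <⟨ ℕ.*-monoˡ-< p 3M<QR ⟩
        (Q ℕ.* R) ℕ.* p
          ≡⟨ swap Q R p ⟩
        R ℕ.* (Q ℕ.* p) ∎)
        where
        open ℕ.≤-Reasoning
        expand : ∀ R M a → R ℕ.* (R ℕ.* (M ℕ.* M) ℕ.+ a ℕ.* (M ℕ.+ M)) ≡
                 (R ℕ.* R ℕ.* M) ℕ.* M ℕ.+ (R ℕ.* a) ℕ.* (M ℕ.+ M)
        expand = ℕ-solver.solve-∀
        collect : ∀ p M → p ℕ.* M ℕ.+ p ℕ.* (M ℕ.+ M) ≡ (3 ℕ.* M) ℕ.* p
        collect = ℕ-solver.solve-∀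
        swap : ∀ Q R p → (Q ℕ.* R) ℕ.* p ≡ R ℕ.* (Q ℕ.* p)
        swap = ℕ-solver.solve-∀

      -- The shift makes w nonnegative and less than 2 Q p, so its quotient by p is a natural number
      -- below 2 Q. On pairs of points the absolute value changes nothing.
      shifted : Pair → ℕ
      shifted e = ∣ w e ℤ.+ + (Q ℕ.* p) ∣

      +shifted : ∀ {e} → Points e → + shifted e ≡ w e ℤ.+ + (Q ℕ.* p)
      +shifted {e} pts = ℤ.0≤i⇒+∣i∣≡i (nonNeg (w e) (ℕ.<⇒≤ (∣w∣<Qp pts)))
        where
        nonNeg : ∀ i {n} → ∣ i ∣ ≤ n → 0ℤ ℤ.≤ i ℤ.+ + n
        nonNeg (+ _)    _ = ℤ.+≤+ z≤n
        nonNeg -[1+ m ] {n} m<n = subst (0ℤ ℤ.≤_) (sym (ℤ.⊖-≥ m<n)) (ℤ.+≤+ z≤n)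

      -- The key determines w : the first component fixes w modulo p, the second one fixes
      -- which multiple of p lies just below it.
      key : Pair → ℕ × ℕ
      key e@((x₁ , _) , (x₂ , _)) = x₁ ℕ.+ x₂ , shifted e ℕ./ p

      keys : List (ℕ × ℕ)
      keys = cartesianProduct (upTo (M ℕ.+ M)) (upTo (Q ℕ.+ Q))

      key∈keys : ∀ {e} → Points e → key e ∈ keys
      key∈keys {e} pts@(pt₁ , pt₂) = ∈-cartesianProduct⁺
        (∈-upTo⁺ (ℕ.+-mono-< (x<M pt₁) (x<M pt₂)))
        (∈-upTo⁺ (ℕ.m<n*o⇒m/o<n {shifted e} {Q ℕ.+ Q} {p} (begin-strict
          shifted e                    ≤⟨ ℤ.∣i+j∣≤∣i∣+∣j∣ (w e) (+ (Q ℕ.* p)) ⟩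
          ∣ w e ∣ ℕ.+ Q ℕ.* p          <⟨ ℕ.+-monoˡ-< (Q ℕ.* p) (∣w∣<Qp pts) ⟩
          Q ℕ.* p ℕ.+ Q ℕ.* p          ≡⟨ sym (ℕ.*-distribʳ-+ p Q Q) ⟩
          (Q ℕ.+ Q) ℕ.* p              ∎)))
        where open ℕ.≤-Reasoning

      -- Multiply out r (L + y₁)(L + y₂) and replace r L by L₀ in the linear term; the rest depends
      -- only on x₁ + x₂.
      w-congruence : ∀ {x₁ y₁ x₂ y₂} → Points ((x₁ , y₁) , (x₂ , y₂)) →
        + p ℤ.∣ w ((x₁ , y₁) , (x₂ , y₂)) ℤ.- (+ r ℤ.* (c ℤ.* c ℤ.* (+ g) ℤ.^ (x₁ ℕ.+ x₂)) ℤ.- + r ℤ.* L ℤ.* L)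
      w-congruence {x₁} {y₁} {x₂} {y₂} (pt₁ , pt₂) = subst (+ p ℤ.∣_) (sym identity)
        (ℤ.∣m∣n⇒∣m-n (ℤ.∣n⇒∣m*n (+ r) (product-congruence pt₁ pt₂))
                     (ℤ.∣n⇒∣m*n (h ℤ.* (+ y₁ ℤ.+ + y₂)) ℤ.∣-refl))
        where
        lem : ∀ r L L₀ G u v → r ℤ.* (u ℤ.* v) ℤ.+ L₀ ℤ.* (u ℤ.+ v) ℤ.- (r ℤ.* G ℤ.- r ℤ.* L ℤ.* L) ≡
          r ℤ.* ((L ℤ.+ u) ℤ.* (L ℤ.+ v) ℤ.- G) ℤ.- (r ℤ.* L ℤ.- L₀) ℤ.* (u ℤ.+ v)
        lem = ℤ-solver.solve-∀
        lem₂ : ∀ L₀ h p s → (L₀ ℤ.+ h ℤ.* p ℤ.- L₀) ℤ.* s ≡ h ℤ.* s ℤ.* p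
        lem₂ = ℤ-solver.solve-∀
        G = c ℤ.* c ℤ.* (+ g) ℤ.^ (x₁ ℕ.+ x₂)
        identity : w ((x₁ , y₁) , (x₂ , y₂)) ℤ.- (+ r ℤ.* G ℤ.- + r ℤ.* L ℤ.* L) ≡
          + r ℤ.* ((L ℤ.+ + y₁) ℤ.* (L ℤ.+ + y₂) ℤ.- G) ℤ.- h ℤ.* (+ y₁ ℤ.+ + y₂) ℤ.* + p
        identity = trans (lem (+ r) L L₀ G (+ y₁) (+ y₂))
          (cong (ℤ._-_ (+ r ℤ.* ((L ℤ.+ + y₁) ℤ.* (L ℤ.+ + y₂) ℤ.- G)))
            (trans (cong (λ z → (z ℤ.- L₀) ℤ.* (+ y₁ ℤ.+ + y₂)) rL≡) (lem₂ L₀ h (+ p) (+ y₁ ℤ.+ + y₂))))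

      w-constant : ∀ {e e′} → Points e → Points e′ → key e ≡ key e′ → w e ≡ w e′
      w-constant {e@((x₁ , _) , (x₂ , _))} {e′@((x₁′ , _) , (x₂′ , _))} pts pts′ keys≡ = ∣∧∣-∣<⇒≡ p∣difference
        (subst (λ i → ∣ i ∣ < p) shift (/-≡⇒∣-∣< p (cong proj₂ keys≡)))
        where
        lem : ∀ a b c → (a ℤ.- c) ℤ.- (b ℤ.- c) ≡ a ℤ.- b
        lem = ℤ-solver.solve-∀
        lem₂ : ∀ a b c → (a ℤ.+ c) ℤ.- (b ℤ.+ c) ≡ a ℤ.- b
        lem₂ = ℤ-solver.solve-∀
        constant : ℕ → ℤ
        constant s = + r ℤ.* (c ℤ.* c ℤ.* (+ g) ℤ.^ s) ℤ.- + r ℤ.* L ℤ.* L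
        p∣difference : + p ℤ.∣ w e ℤ.- w e′
        p∣difference = subst (+ p ℤ.∣_) (lem (w e) (w e′) (constant (x₁ ℕ.+ x₂)))
          (ℤ.∣m∣n⇒∣m-n (w-congruence pts)
            (subst (λ s → + p ℤ.∣ w e′ ℤ.- constant s) (sym (cong proj₁ keys≡)) (w-congruence pts′)))
        shift : + shifted e ℤ.- + shifted e′ ≡ w e ℤ.- w e′
        shift = trans (cong₂ ℤ._-_ (+shifted pts) (+shifted pts′)) (lem₂ (w e) (w e′) (+ (Q ℕ.* p)))

      -- Otherwise r (L + y) = h p, while 0 < r < p and L + y ≡ c g ^ x is a unit modulo p.
      factor≢0 : ∀ {x y} → Point (x , y) → + r ℤ.* + y ℤ.+ L₀ ≢ 0ℤ
      factor≢0 {x} {y} pt factor≡0 = [ ℕ.>⇒∤ {{ℕ.>-nonZero 1≤r}} r<p ∘ ℤ.∣⇒∣ᵤ , p∤y pt ]′ (euclidsLemmaℤ pp (+ r)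
        (subst (+ p ℤ.∣_) (sym identity) (ℤ.∣n⇒∣m*n h ℤ.∣-refl)))
        where
        lem : ∀ L₀ h p b → (L₀ ℤ.+ h ℤ.* p) ℤ.+ b ≡ (b ℤ.+ L₀) ℤ.+ h ℤ.* p
        lem = ℤ-solver.solve-∀
        identity : + r ℤ.* (L ℤ.+ + y) ≡ h ℤ.* + p
        identity = trans (ℤ.*-distribˡ-+ (+ r) L (+ y)) (trans (cong (ℤ._+ (+ r ℤ.* + y)) rL≡)
          (trans (lem L₀ h (+ p) (+ r ℤ.* + y)) (trans (cong (ℤ._+ (h ℤ.* + p)) factor≡0) (ℤ.+-identityˡ _))))

      ordinates : Pair → ℤ × ℤ
      ordinates ((_ , y₁) , (_ , y₂)) = + y₁ , + y₂

      on-hyperbola : ∀ {e w₀} → Points e → w e ≡ w₀ → OnHyperbola (+ r) L₀ w₀ M (ordinates e)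
      on-hyperbola (pt₁ , pt₂) eq = onHyperbola eq (factor≢0 pt₁) (factor≢0 pt₂) (y≤M pt₁) (y≤M pt₂)

      -- For fixed w and y₁ the equation is linear in y₂ with the nonzero coefficient r y₁ + L₀. The
      -- ordinates then determine the abscissae because M < t.
      y₁-determines : ∀ {e e′} → Points e → Points e′ → key e ≡ key e′ →
        proj₁ (ordinates e) ≡ proj₁ (ordinates e′) → e ≡ e′
      y₁-determines {(x₁ , y₁) , (x₂ , y₂)} {(x₁′ , _) , (x₂′ , y₂′)} pts@(pt₁ , pt₂) pts′@(pt₁′ , pt₂′) keys≡ refl =
        cong₂ _,_ (cong (_, y₁) (x-unique pt₁ pt₁′)) (same-second (ℤ.+-injective y₂≡y₂′))
        where
        lem : ∀ r L₀ u v v′ → (r ℤ.* u ℤ.+ L₀) ℤ.* (v ℤ.- v′) ≡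
          (r ℤ.* (u ℤ.* v) ℤ.+ L₀ ℤ.* (u ℤ.+ v)) ℤ.- (r ℤ.* (u ℤ.* v′) ℤ.+ L₀ ℤ.* (u ℤ.+ v′))
        lem = ℤ-solver.solve-∀
        y₂≡y₂′ : + y₂ ≡ + y₂′
        y₂≡y₂′ = ℤ.i-j≡0⇒i≡j (+ y₂) (+ y₂′) ([ (λ e → contradiction e (factor≢0 pt₁)) , id ]′
          (ℤ.i*j≡0⇒i≡0∨j≡0 (+ r ℤ.* + y₁ ℤ.+ L₀)
            (trans (lem (+ r) L₀ (+ y₁) (+ y₂) (+ y₂′)) (ℤ.i≡j⇒i-j≡0 (w-constant pts pts′ keys≡)))))
        same-second : y₂ ≡ y₂′ → (x₂ , y₂) ≡ (x₂′ , y₂′)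
        same-second refl = cong (_, y₂) (x-unique pt₂ pt₂′)

      affine : ℤ → ℤ → Pair → ℤ
      affine A B e = A ℤ.* proj₁ (ordinates e) ℤ.+ B

      covered-fibre : ∀ s {A B ks} → A ≢ 0ℤ →
        AtMost (length ks) (λ e → (Points e × key e ≡ s) × affine A B e ∈ ks)
      covered-fibre s {A} {B} {ks} A≢0 = atMost-injective
        {P = λ e → (Points e × key e ≡ s) × affine A B e ∈ ks} ℤ._≟_ (affine A B) ks proj₂
        λ {e} {e′} ((pts , key≡) , _) ((pts′ , key≡′) , _) eq →
          y₁-determines pts pts′ (trans key≡ (sym key≡′))
            (ℤ.*-cancelˡ-≡ A (proj₁ (ordinates e)) (proj₁ (ordinates e′)) {{ℤ.≢-nonZero A≢0}}
              (∙-cancelʳ ℤ.+-0-abelianGroup B (A ℤ.* proj₁ (ordinates e)) (A ℤ.* proj₁ (ordinates e′)) eq))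

      fibre-on-hyperbola : ∀ {s e₀ es} → Points e₀ → key e₀ ≡ s → All (λ e → Points e × key e ≡ s) es →
        All (OnHyperbola (+ r) L₀ (w e₀) M) (map ordinates es)
      fibre-on-hyperbola {e₀ = e₀} pts₀ key₀ all = All.map⁺ (All.map
        (λ {e} (pts , key≡) → on-hyperbola {e} {w e₀} pts (w-constant pts pts₀ (trans key≡ (sym key₀)))) all)

      fibre≤D : ∀ s → AtMost D (λ e → Points e × key e ≡ s)
      fibre≤D s {[]} _ _ = z≤n
      fibre≤D s {es@(e₀ ∷ _)} unique all@((pts₀ , key₀) ∷ _) =
        let A , B , ks , A≢0 , cover , len = hyperbola-cover {k} bound r≢0 1≤C 1≤M (fibre-on-hyperbola {e₀ = e₀} pts₀ key₀ all)
        in ℕ.≤-trans (covered-fibre s A≢0 unique (All.zip (all , All.map⁻ cover))) (≤D (length ks) len)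
        where
        r≢0 : + r ≢ 0ℤ
        r≢0 refl = contradiction 1≤r λ ()

    points-bound : ∀ {xs} → Unique xs → All Point xs →
      length xs ℕ.* length xs ≤ (M ℕ.+ M) ℕ.* (Q ℕ.+ Q) ℕ.* D
    points-bound = atMost-square (subst (λ n → AtMost (n ℕ.* D) Points)
      (trans (length-cartesianProduct (upTo (M ℕ.+ M)) (upTo (Q ℕ.+ Q))) (cong₂ ℕ._*_ (length-upTo (M ℕ.+ M)) (length-upTo (Q ℕ.+ Q))))
      (atMost-fibres (≡-dec ℕ._≟_ ℕ._≟_) key keys key∈keys fibre≤D))

-- Estimates

floorInverse : (f : ℕ → ℕ) → f 0 ≡ 0 → (∀ n → f n < f (suc n)) → ∀ X → ∃[ n ] f n ≤ X × X < f (suc n)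
floorInverse f f0≡0 mono zero = 0 , ℕ.≤-reflexive f0≡0 , subst (_< f 1) f0≡0 (mono 0)
floorInverse f f0≡0 mono (suc X) with floorInverse f f0≡0 mono X
... | n , fn≤X , X<f with f (suc n) ℕ.≤? suc X
...   | yes f≤ = suc n , f≤ , ℕ.≤-<-trans X<f (mono (suc n))
...   | no  f≰ = n , ℕ.m≤n⇒m≤1+n fn≤X , ℕ.≰⇒> f≰

floorRoot : ∀ v .{{_ : NonZero v}} X → ∃[ n ] n ℕ.^ v ≤ X × X < suc n ℕ.^ v
floorRoot v@(suc _) = floorInverse (ℕ._^ v) refl (λ n → ℕ.^-monoˡ-< v (ℕ.n<1+n n))

^-cancelˡ-≤ : ∀ v .{{_ : NonZero v}} {m n} → m ℕ.^ v ≤ n ℕ.^ v → m ≤ n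
^-cancelˡ-≤ v m^v≤n^v = ℕ.≮⇒≥ λ n<m → ℕ.<⇒≱ (ℕ.^-monoˡ-< v n<m) m^v≤n^v

square-cancel-≤ : ∀ {m n} → m ℕ.* m ≤ n ℕ.* n → m ≤ n
square-cancel-≤ mm≤nn = ℕ.≮⇒≥ λ n<m → ℕ.<⇒≱ (ℕ.*-mono-< n<m n<m) mm≤nn

1≤^ : ∀ {m} n → 1 ≤ m → 1 ≤ m ℕ.^ n
1≤^ {m} n 1≤m = ℕ.>-nonZero⁻¹ _ {{ℕ.m^n≢0 m n {{ℕ.>-nonZero 1≤m}}}}

floorRoot≥1 : ∀ v {X n} → 1 ≤ X → X < suc n ℕ.^ v → 1 ≤ n
floorRoot≥1 v {X} {zero} 1≤X X< = contradiction 1≤X (ℕ.<⇒≱ (subst (X <_) (ℕ.^-zeroˡ v) X<))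
floorRoot≥1 v {n = suc n} _ _ = s≤s z≤n

suc≤2* : ∀ {n} → 1 ≤ n → suc n ≤ 2 ℕ.* n
suc≤2* {n} 1≤n = ℕ.+-mono-≤ 1≤n (ℕ.m≤m+n n 0)

floorRoot-double : ∀ v {X n} → 1 ≤ X → X < suc n ℕ.^ v → X ≤ (2 ℕ.* n) ℕ.^ v
floorRoot-double v {X} {n} 1≤X X< = ℕ.≤-trans (ℕ.<⇒≤ X<) (ℕ.^-monoˡ-≤ v (suc≤2* (floorRoot≥1 v {X} {n} 1≤X X<)))

-- The root of p is approximated from above, since 1 / m has to lie below p ^ (-1/4); the excess
-- costs only a constant.
suc-root-≤ : ∀ {X n} → 1 ≤ X → n ℕ.^ 4 ≤ X → X < suc n ℕ.^ 4 → suc n ℕ.^ 4 ≤ 16 ℕ.* X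
suc-root-≤ {X} {n} 1≤X n⁴≤X X< = begin
  suc n ℕ.^ 4         ≤⟨ ℕ.^-monoˡ-≤ 4 (suc≤2* (floorRoot≥1 4 {X} {n} 1≤X X<)) ⟩
  (2 ℕ.* n) ℕ.^ 4     ≡⟨ ^-distribʳ-* 4 2 n ⟩
  16 ℕ.* n ℕ.^ 4      ≤⟨ ℕ.*-monoʳ-≤ 16 n⁴≤X ⟩
  16 ℕ.* X            ∎
  where open ℕ.≤-Reasoning

-- For R ≈ √(p / M), m ≈ p ^ 1/4, b ≈ M ^ 3/4, n ≈ M ^ ρ with 1/2 < ρ < 1/2 + ε, and the
-- divisor bound D.
curve-estimate : ∀ {M p J R Q D b m n E} → 1 ≤ R → 1 ≤ E →
  J ℕ.* J ≤ (M ℕ.+ M) ℕ.* (Q ℕ.+ Q) ℕ.* D →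
  Q ℕ.* R ≤ 3 ℕ.* M ℕ.+ R →
  p ≤ 4 ℕ.* (R ℕ.* R ℕ.* M) →
  m ℕ.^ 4 ≤ 16 ℕ.* p →
  M ℕ.^ 3 ≤ 16 ℕ.* b ℕ.^ 4 →
  M ℕ.* D ≤ E ℕ.* (2 ℕ.* n ℕ.* (2 ℕ.* n)) →
  4 ℕ.* (m ℕ.* J) ≤ 160 ℕ.* E ℕ.* ((m ℕ.+ b) ℕ.* n)
curve-estimate {M} {p} {J} {R} {Q} {D} {b} {m} {n} {E} 1≤R 1≤E J² QR≤ p≤ m⁴≤ M³≤ MD≤ = begin
  4 ℕ.* (m ℕ.* J)                       ≤⟨ ℕ.*-monoʳ-≤ 4 (square-cancel-≤ {m ℕ.* J} {40 ℕ.* E ℕ.* ((m ℕ.+ b) ℕ.* n)} mJ²) ⟩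
  4 ℕ.* (40 ℕ.* E ℕ.* ((m ℕ.+ b) ℕ.* n)) ≡⟨ lem₁ E ((m ℕ.+ b) ℕ.* n) ⟩
  160 ℕ.* E ℕ.* ((m ℕ.+ b) ℕ.* n)       ∎
  where
  open ℕ.≤-Reasoning
  instance _ = ℕ.>-nonZero 1≤R
  instance _ = ℕ.>-nonZero 1≤E
  lem₁ : ∀ E x → 4 ℕ.* (40 ℕ.* E ℕ.* x) ≡ 160 ℕ.* E ℕ.* x
  lem₁ = ℕ-solver.solve-∀
  lem₂ : ∀ m M → (m ℕ.* m ℕ.* M) ℕ.* (m ℕ.* m ℕ.* M) ≡ m ℕ.* (m ℕ.* (m ℕ.* (m ℕ.* 1))) ℕ.* (M ℕ.* M)
  lem₂ = ℕ-solver.solve-∀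
  lem₃ : ∀ R M → 16 ℕ.* (4 ℕ.* (R ℕ.* R ℕ.* M)) ℕ.* (M ℕ.* M) ≡ 64 ℕ.* (R ℕ.* R) ℕ.* (M ℕ.* (M ℕ.* (M ℕ.* 1)))
  lem₃ = ℕ-solver.solve-∀
  lem₄ : ∀ R b → 64 ℕ.* (R ℕ.* R) ℕ.* (16 ℕ.* (b ℕ.* (b ℕ.* (b ℕ.* (b ℕ.* 1))))) ≡
    (32 ℕ.* (b ℕ.* b ℕ.* R)) ℕ.* (32 ℕ.* (b ℕ.* b ℕ.* R))
  lem₄ = ℕ-solver.solve-∀
  -- Eliminates p: this is the integer form of M / R ≪ (b / m)², where b / m ≈ M ^ 3/4 p ^ -1/4.
  m²M≤ : m ℕ.* m ℕ.* M ≤ 32 ℕ.* (b ℕ.* b ℕ.* R)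
  m²M≤ = square-cancel-≤ {m ℕ.* m ℕ.* M} {32 ℕ.* (b ℕ.* b ℕ.* R)} (begin
    (m ℕ.* m ℕ.* M) ℕ.* (m ℕ.* m ℕ.* M)             ≡⟨ lem₂ m M ⟩
    m ℕ.^ 4 ℕ.* (M ℕ.* M)                           ≤⟨ ℕ.*-monoˡ-≤ (M ℕ.* M) (ℕ.≤-trans m⁴≤ (ℕ.*-monoʳ-≤ 16 p≤)) ⟩
    16 ℕ.* (4 ℕ.* (R ℕ.* R ℕ.* M)) ℕ.* (M ℕ.* M)    ≡⟨ lem₃ R M ⟩
    64 ℕ.* (R ℕ.* R) ℕ.* M ℕ.^ 3                    ≤⟨ ℕ.*-monoʳ-≤ (64 ℕ.* (R ℕ.* R)) M³≤ ⟩
    64 ℕ.* (R ℕ.* R) ℕ.* (16 ℕ.* b ℕ.^ 4)           ≡⟨ lem₄ R b ⟩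
    (32 ℕ.* (b ℕ.* b ℕ.* R)) ℕ.* (32 ℕ.* (b ℕ.* b ℕ.* R)) ∎)
  lem₅ : ∀ m J R → (m ℕ.* J) ℕ.* (m ℕ.* J) ℕ.* R ≡ m ℕ.* m ℕ.* R ℕ.* (J ℕ.* J)
  lem₅ = ℕ-solver.solve-∀
  lem₆ : ∀ m R M Q D → m ℕ.* m ℕ.* R ℕ.* ((M ℕ.+ M) ℕ.* (Q ℕ.+ Q) ℕ.* D) ≡
    4 ℕ.* (M ℕ.* D) ℕ.* (m ℕ.* m) ℕ.* (Q ℕ.* R)
  lem₆ = ℕ-solver.solve-∀
  lem₇ : ∀ x m M R → 4 ℕ.* x ℕ.* (m ℕ.* m) ℕ.* (3 ℕ.* M ℕ.+ R) ≡ 4 ℕ.* x ℕ.* (3 ℕ.* (m ℕ.* m ℕ.* M) ℕ.+ m ℕ.* m ℕ.* R)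
  lem₇ = ℕ-solver.solve-∀
  lem₈ : ∀ m b R → 96 ℕ.* (m ℕ.+ b) ℕ.* (m ℕ.+ b) ℕ.* R ≡
    (3 ℕ.* (32 ℕ.* (b ℕ.* b ℕ.* R)) ℕ.+ m ℕ.* m ℕ.* R) ℕ.+ (95 ℕ.* (m ℕ.* m ℕ.* R) ℕ.+ 192 ℕ.* (m ℕ.* b ℕ.* R))
  lem₈ = ℕ-solver.solve-∀
  lem₉ : ∀ m b R E n → 4 ℕ.* (E ℕ.* (2 ℕ.* n ℕ.* (2 ℕ.* n))) ℕ.* (96 ℕ.* (m ℕ.+ b) ℕ.* (m ℕ.+ b) ℕ.* R) ℕ.+
    64 ℕ.* E ℕ.* (((m ℕ.+ b) ℕ.* n) ℕ.* ((m ℕ.+ b) ℕ.* n)) ℕ.* R ≡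
    1600 ℕ.* E ℕ.* (((m ℕ.+ b) ℕ.* n) ℕ.* ((m ℕ.+ b) ℕ.* n)) ℕ.* R
  lem₉ = ℕ-solver.solve-∀
  lem₁₀ : ∀ E x → 1600 ℕ.* (E ℕ.* E) ℕ.* (x ℕ.* x) ≡ (40 ℕ.* E ℕ.* x) ℕ.* (40 ℕ.* E ℕ.* x)
  lem₁₀ = ℕ-solver.solve-∀
  X = (m ℕ.+ b) ℕ.* n
  -- The factor R is kept because Q is controlled only through Q R.
  mJ²R : (m ℕ.* J) ℕ.* (m ℕ.* J) ℕ.* R ≤ 1600 ℕ.* E ℕ.* (X ℕ.* X) ℕ.* R
  mJ²R = begin
    (m ℕ.* J) ℕ.* (m ℕ.* J) ℕ.* R                              ≡⟨ lem₅ m J R ⟩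
    m ℕ.* m ℕ.* R ℕ.* (J ℕ.* J)                                ≤⟨ ℕ.*-monoʳ-≤ (m ℕ.* m ℕ.* R) J² ⟩
    m ℕ.* m ℕ.* R ℕ.* ((M ℕ.+ M) ℕ.* (Q ℕ.+ Q) ℕ.* D)          ≡⟨ lem₆ m R M Q D ⟩
    4 ℕ.* (M ℕ.* D) ℕ.* (m ℕ.* m) ℕ.* (Q ℕ.* R)                ≤⟨ ℕ.*-monoʳ-≤ (4 ℕ.* (M ℕ.* D) ℕ.* (m ℕ.* m)) QR≤ ⟩
    4 ℕ.* (M ℕ.* D) ℕ.* (m ℕ.* m) ℕ.* (3 ℕ.* M ℕ.+ R)          ≡⟨ lem₇ (M ℕ.* D) m M R ⟩
    4 ℕ.* (M ℕ.* D) ℕ.* (3 ℕ.* (m ℕ.* m ℕ.* M) ℕ.+ m ℕ.* m ℕ.* R)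
      ≤⟨ ℕ.*-mono-≤ (ℕ.*-monoʳ-≤ 4 MD≤) (ℕ.≤-trans (ℕ.+-monoˡ-≤ (m ℕ.* m ℕ.* R) (ℕ.*-monoʳ-≤ 3 m²M≤))
           (ℕ.≤-trans (ℕ.m≤m+n _ _) (ℕ.≤-reflexive (sym (lem₈ m b R))))) ⟩
    4 ℕ.* (E ℕ.* (2 ℕ.* n ℕ.* (2 ℕ.* n))) ℕ.* (96 ℕ.* (m ℕ.+ b) ℕ.* (m ℕ.+ b) ℕ.* R)
      -- 4 · 4 · 96 = 1536 is raised to 1600 = 40², and E is raised to E² afterwards, so that a
      -- square root can be taken.
      ≤⟨ ℕ.≤-trans (ℕ.m≤m+n _ _) (ℕ.≤-reflexive (lem₉ m b R E n)) ⟩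
    1600 ℕ.* E ℕ.* (X ℕ.* X) ℕ.* R                             ∎
  mJ² : (m ℕ.* J) ℕ.* (m ℕ.* J) ≤ (40 ℕ.* E ℕ.* X) ℕ.* (40 ℕ.* E ℕ.* X)
  mJ² = begin
    (m ℕ.* J) ℕ.* (m ℕ.* J)              ≤⟨ ℕ.*-cancelʳ-≤ _ _ R mJ²R ⟩
    1600 ℕ.* E ℕ.* (X ℕ.* X)             ≤⟨ ℕ.*-monoˡ-≤ (X ℕ.* X) (ℕ.*-monoʳ-≤ 1600 (ℕ.m≤m*n E E)) ⟩
    1600 ℕ.* (E ℕ.* E) ℕ.* (X ℕ.* X)     ≡⟨ lem₁₀ E X ⟩
    (40 ℕ.* E ℕ.* X) ℕ.* (40 ℕ.* E ℕ.* X) ∎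

-- Its fourth power is 81 · 2 ^ (4 v) · C⁴, a perfect fourth power above the constant 36 · 2 ^ (4 v)
-- · C of the hyperbola bound.
divisor-constant : ℕ → ℕ → ℕ
divisor-constant v C = 3 ℕ.* (2 ℕ.^ v ℕ.* C)

1≤divisor-constant : ∀ v {C} → 1 ≤ C → 1 ≤ divisor-constant v C
1≤divisor-constant v {C} 1≤C = ℕ.*-mono-≤ {1} {3} {1} {2 ℕ.^ v ℕ.* C} (s≤s z≤n) (ℕ.*-mono-≤ (1≤^ {2} v (s≤s z≤n)) 1≤C)

-- The order 4 v of the divisor bound is matched to N = O(M⁴): a fourth root leaves f ^ v = O(M),
-- that is, f = O(M ^ (1/v)).
root-bound : ∀ {v C M f} → 1 ≤ C → f ℕ.^ (v ℕ.* 4) ≤ 2 ℕ.^ (v ℕ.* 4) ℕ.* (C ℕ.* (36 ℕ.* M ℕ.^ 4)) →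
  f ℕ.^ v ≤ divisor-constant v C ℕ.* M
root-bound {v} {C} {M} {f} 1≤C h = ^-cancelˡ-≤ 4 (begin
  (f ℕ.^ v) ℕ.^ 4                                      ≡⟨ ℕ.^-*-assoc f v 4 ⟩
  f ℕ.^ (v ℕ.* 4)                                      ≤⟨ h ⟩
  2 ℕ.^ (v ℕ.* 4) ℕ.* (C ℕ.* (36 ℕ.* M ℕ.^ 4))
    ≤⟨ ℕ.*-monoʳ-≤ (2 ℕ.^ (v ℕ.* 4)) (ℕ.*-mono-≤ (ℕ.m≤m*n C (C ℕ.^ 3)) (ℕ.*-monoˡ-≤ (M ℕ.^ 4) (ℕ.m≤m+n 36 45))) ⟩
  2 ℕ.^ (v ℕ.* 4) ℕ.* (C ℕ.^ 4 ℕ.* (81 ℕ.* M ℕ.^ 4))   ≡⟨ cong (ℕ._* (C ℕ.^ 4 ℕ.* (81 ℕ.* M ℕ.^ 4))) (sym (ℕ.^-*-assoc 2 v 4)) ⟩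
  (2 ℕ.^ v) ℕ.^ 4 ℕ.* (C ℕ.^ 4 ℕ.* (81 ℕ.* M ℕ.^ 4))   ≡⟨ regroup ((2 ℕ.^ v) ℕ.^ 4) (C ℕ.^ 4) (M ℕ.^ 4) ⟩
  (81 ℕ.* ((2 ℕ.^ v) ℕ.^ 4 ℕ.* C ℕ.^ 4)) ℕ.* M ℕ.^ 4   ≡⟨ cong (λ x → (81 ℕ.* x) ℕ.* M ℕ.^ 4) (sym (^-distribʳ-* 4 (2 ℕ.^ v) C)) ⟩
  (81 ℕ.* (2 ℕ.^ v ℕ.* C) ℕ.^ 4) ℕ.* M ℕ.^ 4           ≡⟨ cong (ℕ._* M ℕ.^ 4) (sym (^-distribʳ-* 4 3 (2 ℕ.^ v ℕ.* C))) ⟩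
  (divisor-constant v C) ℕ.^ 4 ℕ.* M ℕ.^ 4             ≡⟨ sym (^-distribʳ-* 4 (divisor-constant v C) M) ⟩
  (divisor-constant v C ℕ.* M) ℕ.^ 4                   ∎)
  where
  open ℕ.≤-Reasoning
  instance _ = ℕ.m^n≢0 C 3 {{ℕ.>-nonZero 1≤C}}
  regroup : ∀ a b c → a ℕ.* (b ℕ.* (81 ℕ.* c)) ≡ (81 ℕ.* (a ℕ.* b)) ℕ.* c
  regroup = ℕ-solver.solve-∀

-- Since v + 1 ≤ 2 u, the factor M ^ (1/v) lost to divisors fits between M and M ^ (2 u / v) ≈ n².
M*D-bound : ∀ {v u M D n E} .{{_ : NonZero v}} → 1 ≤ M → 1 ≤ E → v < 2 ℕ.* u →
  D ℕ.^ v ≤ E ℕ.* M → M ℕ.^ u ≤ (2 ℕ.* n) ℕ.^ v →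
  M ℕ.* D ≤ E ℕ.* (2 ℕ.* n ℕ.* (2 ℕ.* n))
M*D-bound {v@(suc v-1)} {u} {M} {D} {n} {E} 1≤M 1≤E v<2u D^v≤ M^u≤ = ^-cancelˡ-≤ v (begin
  (M ℕ.* D) ℕ.^ v                             ≡⟨ ^-distribʳ-* v M D ⟩
  M ℕ.^ v ℕ.* D ℕ.^ v                         ≤⟨ ℕ.*-monoʳ-≤ (M ℕ.^ v) D^v≤ ⟩
  M ℕ.^ v ℕ.* (E ℕ.* M)                       ≡⟨ regroup (M ℕ.^ v) E M ⟩
  E ℕ.* M ℕ.^ suc v                           ≤⟨ ℕ.*-mono-≤ (ℕ.m≤m*n E (E ℕ.^ v-1)) (ℕ.^-monoʳ-≤ M v<2u) ⟩
  E ℕ.^ v ℕ.* M ℕ.^ (2 ℕ.* u)                 ≡⟨ cong (E ℕ.^ v ℕ.*_) (double u) ⟩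
  E ℕ.^ v ℕ.* (M ℕ.^ u ℕ.* M ℕ.^ u)           ≤⟨ ℕ.*-monoʳ-≤ (E ℕ.^ v) (ℕ.*-mono-≤ M^u≤ M^u≤) ⟩
  E ℕ.^ v ℕ.* ((2 ℕ.* n) ℕ.^ v ℕ.* (2 ℕ.* n) ℕ.^ v)   ≡⟨ cong (E ℕ.^ v ℕ.*_) (sym (^-distribʳ-* v (2 ℕ.* n) (2 ℕ.* n))) ⟩
  E ℕ.^ v ℕ.* (2 ℕ.* n ℕ.* (2 ℕ.* n)) ℕ.^ v   ≡⟨ sym (^-distribʳ-* v E (2 ℕ.* n ℕ.* (2 ℕ.* n))) ⟩
  (E ℕ.* (2 ℕ.* n ℕ.* (2 ℕ.* n))) ℕ.^ v       ∎)
  where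
  open ℕ.≤-Reasoning
  instance _ = ℕ.>-nonZero 1≤M
  instance _ = ℕ.m^n≢0 E v-1 {{ℕ.>-nonZero 1≤E}}
  regroup : ∀ a e m → a ℕ.* (e ℕ.* m) ≡ e ℕ.* (m ℕ.* a)
  regroup = ℕ-solver.solve-∀
  double : ∀ u → M ℕ.^ (2 ℕ.* u) ≡ M ℕ.^ u ℕ.* M ℕ.^ u
  double u = trans (ℕ.^-distribˡ-+-* M u (u ℕ.+ 0)) (cong (λ x → M ℕ.^ u ℕ.* M ℕ.^ x) (ℕ.+-identityʳ u))

-- Cuts of rationals

/-mono-≤ : ∀ a b c d .{{_ : NonZero b}} .{{_ : NonZero d}} →
  a ℕ.* d ℕ.≤ c ℕ.* b → (+ a) / b ℚ.≤ (+ c) / d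
/-mono-≤ a b@(suc b-1) c d@(suc d-1) ad≤cb = ℚ.toℚᵘ-cancel-≤ (begin
  toℚᵘ ((+ a) / b)   ≃⟨ ℚ.toℚᵘ-fromℚᵘ (mkℚᵘ (+ a) b-1) ⟩
  mkℚᵘ (+ a) b-1     ≤⟨ ℚᵘ.*≤* (subst₂ ℤ._≤_ (ℤ.pos-* a d) (ℤ.pos-* c b) (ℤ.+≤+ ad≤cb)) ⟩
  mkℚᵘ (+ c) d-1     ≃⟨ ℚ.toℚᵘ-fromℚᵘ (mkℚᵘ (+ c) d-1) ⟨
  toℚᵘ ((+ c) / d)   ∎)
  where open ℚᵘ.≤-Reasoning

/-mono-< : ∀ a b c d .{{_ : NonZero b}} .{{_ : NonZero d}} →
  a ℕ.* d ℕ.< c ℕ.* b → (+ a) / b ℚ.< (+ c) / d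
/-mono-< a b@(suc b-1) c d@(suc d-1) ad<cb = ℚ.toℚᵘ-cancel-< (begin-strict
  toℚᵘ ((+ a) / b)   ≃⟨ ℚ.toℚᵘ-fromℚᵘ (mkℚᵘ (+ a) b-1) ⟩
  mkℚᵘ (+ a) b-1     <⟨ ℚᵘ.*<* (subst₂ ℤ._<_ (ℤ.pos-* a d) (ℤ.pos-* c b) (ℤ.+<+ ad<cb)) ⟩
  mkℚᵘ (+ c) d-1     ≃⟨ ℚ.toℚᵘ-fromℚᵘ (mkℚᵘ (+ c) d-1) ⟨
  toℚᵘ ((+ c) / d)   ∎)
  where open ℚᵘ.≤-Reasoning

/-positive : ∀ a b .{{_ : NonZero b}} → 1 ℕ.≤ a → 0ℚ ℚ.< (+ a) / b
/-positive a b 1≤a = /-mono-< 0 1 a b (subst (1 ℕ.≤_) (sym (ℕ.*-identityʳ a)) 1≤a)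

/-* : ∀ a b c d .{{_ : NonZero b}} .{{_ : NonZero d}} .{{_ : NonZero (b ℕ.* d)}} →
  ((+ a) / b) ℚ.* ((+ c) / d) ≡ (+ (a ℕ.* c)) / (b ℕ.* d)
/-* a b@(suc b-1) c d@(suc d-1) = ℚ.toℚᵘ-injective (begin-equality
  toℚᵘ (((+ a) / b) ℚ.* ((+ c) / d))           ≃⟨ ℚ.toℚᵘ-homo-* ((+ a) / b) ((+ c) / d) ⟩
  toℚᵘ ((+ a) / b) ℚᵘ.* toℚᵘ ((+ c) / d)       ≃⟨ ℚᵘ.*-cong (ℚ.toℚᵘ-fromℚᵘ (mkℚᵘ (+ a) b-1)) (ℚ.toℚᵘ-fromℚᵘ (mkℚᵘ (+ c) d-1)) ⟩
  mkℚᵘ (+ a) b-1 ℚᵘ.* mkℚᵘ (+ c) d-1           ≡⟨ cong (λ n → mkℚᵘ n (ℕ.pred (b ℕ.* d))) (sym (ℤ.pos-* a c)) ⟩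
  mkℚᵘ (+ (a ℕ.* c)) (ℕ.pred (b ℕ.* d))        ≃⟨ ℚ.toℚᵘ-fromℚᵘ (mkℚᵘ (+ (a ℕ.* c)) (ℕ.pred (b ℕ.* d))) ⟨
  toℚᵘ ((+ (a ℕ.* c)) / (b ℕ.* d))             ∎)
  where open ℚᵘ.≤-Reasoning

/-+ : ∀ a b c d .{{_ : NonZero b}} .{{_ : NonZero d}} .{{_ : NonZero (b ℕ.* d)}} →
  ((+ a) / b) ℚ.+ ((+ c) / d) ≡ (+ (a ℕ.* d ℕ.+ c ℕ.* b)) / (b ℕ.* d)
/-+ a b@(suc b-1) c d@(suc d-1) = ℚ.toℚᵘ-injective (begin-equality
  toℚᵘ (((+ a) / b) ℚ.+ ((+ c) / d))           ≃⟨ ℚ.toℚᵘ-homo-+ ((+ a) / b) ((+ c) / d) ⟩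
  toℚᵘ ((+ a) / b) ℚᵘ.+ toℚᵘ ((+ c) / d)       ≃⟨ ℚᵘ.+-cong (ℚ.toℚᵘ-fromℚᵘ (mkℚᵘ (+ a) b-1)) (ℚ.toℚᵘ-fromℚᵘ (mkℚᵘ (+ c) d-1)) ⟩
  mkℚᵘ (+ a) b-1 ℚᵘ.+ mkℚᵘ (+ c) d-1           ≡⟨ cong (λ n → mkℚᵘ n (ℕ.pred (b ℕ.* d))) (cong₂ ℤ._+_ (sym (ℤ.pos-* a d)) (sym (ℤ.pos-* c b))) ⟩
  mkℚᵘ (+ (a ℕ.* d ℕ.+ c ℕ.* b)) (ℕ.pred (b ℕ.* d))  ≃⟨ ℚ.toℚᵘ-fromℚᵘ (mkℚᵘ (+ (a ℕ.* d ℕ.+ c ℕ.* b)) (ℕ.pred (b ℕ.* d))) ⟨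
  toℚᵘ ((+ (a ℕ.* d ℕ.+ c ℕ.* b)) / (b ℕ.* d)) ∎)
  where open ℚᵘ.≤-Reasoning

/-^ : ∀ a b v .{{_ : NonZero b}} .{{_ : NonZero (b ℕ.^ v)}} →
  ((+ a) / b) ^ℚ v ≡ (+ (a ℕ.^ v)) / (b ℕ.^ v)
/-^ a b zero    = refl
/-^ a b (suc v) = trans (cong (((+ a) / b) ℚ.*_) (/-^ a b v)) (/-* a b (a ℕ.^ v) (b ℕ.^ v))
  where instance _ = ℕ.m^n≢0 b v

-- Halving n turns the weak inequality into the strict one that a lower cut demands.
power-below : ∀ n M u v .{{_ : NonZero v}} → 1 ℕ.≤ M → n ℕ.^ v ℕ.≤ M ℕ.^ u →
  ((+ n) / 2) ^ℚ v ℚ.< (+ (M ℕ.^ u)) / 1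
power-below n M u v 1≤M n^v≤M^u = subst (ℚ._< (+ (M ℕ.^ u)) / 1) (sym (/-^ n 2 v))
  (/-mono-< (n ℕ.^ v) (2 ℕ.^ v) (M ℕ.^ u) 1 (begin-strict
    n ℕ.^ v ℕ.* 1          ≡⟨ ℕ.*-identityʳ _ ⟩
    n ℕ.^ v                ≤⟨ n^v≤M^u ⟩
    M ℕ.^ u                <⟨ ℕ.m<m*n (M ℕ.^ u) (2 ℕ.^ v) (ℕ.^-monoʳ-< 2 (ℕ.n<1+n 1) (ℕ.>-nonZero⁻¹ v)) ⟩
    M ℕ.^ u ℕ.* 2 ℕ.^ v    ∎))
  where
  open ℕ.≤-Reasoning
  instance
    _ = ℕ.m^n≢0 2 v
    _ = ℕ.m^n≢0 M u {{ℕ.>-nonZero 1≤M}}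

inverse-power-below : ∀ m p .{{_ : NonZero m}} → p ℕ.< m ℕ.^ 4 →
  PowerBelow ((+ 1) / m) p -[1+ 0 ] 4
inverse-power-below m p p<m⁴ = subst (ℚ._< 1ℚ)
  (sym (trans (cong (ℚ._* ((+ (p ℕ.^ 1)) / 1)) (/-^ 1 m 4)) (/-* (1 ℕ.^ 4) (m ℕ.^ 4) (p ℕ.^ 1) 1)))
  (/-mono-< (1 ℕ.^ 4 ℕ.* p ℕ.^ 1) (m ℕ.^ 4 ℕ.* 1) 1 1
    (subst₂ ℕ._<_ (sym (trans (ℕ.*-identityʳ _) (trans (ℕ.*-identityˡ _) (ℕ.^-identityʳ p))))
                  (sym (trans (ℕ.*-identityˡ _) (ℕ.*-identityʳ _))) p<m⁴))
  where
  instance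
    _ = ℕ.m^n≢0 m 4
    _ = ℕ.m*n≢0 (m ℕ.^ 4) 1

fromℚ : ℚ → ℝ
fromℚ x = record
  { lower           = ℚ._< x
  ; upper           = x ℚ.<_
  ; lower-inhabited = x ℚ.- 1ℚ , subst (x ℚ.- 1ℚ ℚ.<_) (ℚ.+-identityʳ x) (ℚ.+-monoʳ-< x (ℚ.negative⁻¹ (ℚ.- 1ℚ)))
  ; upper-inhabited = x ℚ.+ 1ℚ , subst (ℚ._< x ℚ.+ 1ℚ) (ℚ.+-identityʳ x) (ℚ.+-monoʳ-< x (ℚ.positive⁻¹ 1ℚ))
  ; lower-rounded   = λ q → mk⇔ ℚ.<-dense λ (_ , q<r , r<x) → ℚ.<-trans q<r r<x
  ; upper-rounded   = λ q → mk⇔ (λ x<q → let r , x<r , r<q = ℚ.<-dense x<q in r , r<q , x<r)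
                                λ (_ , r<q , x<r) → ℚ.<-trans x<r r<q
  ; disjoint        = λ q (q<x , x<q) → ℚ.<-asym q<x x<q
  ; located         = located
  }
  where
  located : ∀ q r → q ℚ.< r → q ℚ.< x ⊎ x ℚ.< r
  located q r q<r with ℚ.<-cmp q x
  ... | tri< q<x _ _  = inj₁ q<x
  ... | tri≈ _ refl _ = inj₂ q<r
  ... | tri> _ _ x<q  = inj₂ (ℚ.<-trans x<q q<r)

½<⇒↧<2↥ : ∀ ρ → ½ ℚ.< ρ → Σ[ u ∈ ℕ ] ↥ ρ ≡ + u × ↧ₙ ρ ℕ.< 2 ℕ.* u
½<⇒↧<2↥ (mkℚ (+ u) v-1 _) (ℚ.*<* lt) = u , refl ,
  subst₂ ℕ._<_ (ℕ.*-identityˡ (suc v-1)) (ℕ.*-comm u 2)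
    (ℤ.drop‿+<+ (subst₂ ℤ._<_ (sym (ℤ.pos-* 1 (suc v-1))) (sym (ℤ.pos-* u 2)) lt))
½<⇒↧<2↥ (mkℚ -[1+ u ] v-1 _) (ℚ.*<* ())

-- Roundedness at 0 yields 0 < r < ε; then q is taken strictly between 1/2 - r and 1/2, so q + r
-- exceeds 1/2 although q does not.
exponent-above-½ : ∀ ε → Positive ε → Σ[ ρ ∈ ℚ ] ½ ℚ.< ρ × (⌊ + 1 / 2 ⌋ +ᶜ lower ε) ρ
exponent-above-½ ε ε>0 =
  let r , 0<r , r<ε = Equivalence.to (ℝ.lower-rounded ε 0ℚ) ε>0
      q , ½-r<q , q<½ = ℚ.<-dense (½-r<½ r 0<r)
  in q ℚ.+ r , subst (ℚ._< q ℚ.+ r) (cancel r) (ℚ.+-monoˡ-< r ½-r<q) , q , r , q<½ , r<ε , ℚ.≤-refl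
  where
  ½-r<½ : ∀ r → 0ℚ ℚ.< r → ½ ℚ.- r ℚ.< ½
  ½-r<½ r 0<r = subst (½ ℚ.- r ℚ.<_) (ℚ.+-identityʳ ½) (ℚ.+-monoʳ-< ½ (ℚ.neg-antimono-< 0<r))
  cancel : ∀ r → ½ ℚ.- r ℚ.+ r ≡ ½
  cancel r = trans (ℚ.+-assoc ½ (ℚ.- r) r) (trans (cong (½ ℚ.+_) (ℚ.+-inverseˡ r)) (ℚ.+-identityʳ ½))

-- The factors of the right-hand side are approximated from below by C, by 1 / 2, b / 2, 1 / m
-- and by n / 2.
cut-bound : ∀ {J M p n m b C} {S : LowerCut} {ρ u} .{{_ : NonZero m}} →
  1 ℕ.≤ M → 1 ℕ.≤ n → 1 ℕ.≤ b → 1 ℕ.≤ C →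
  b ℕ.^ 4 ℕ.≤ M ℕ.^ 3 → p ℕ.< m ℕ.^ 4 →
  S ρ → ↥ ρ ≡ + u → n ℕ.^ ↧ₙ ρ ℕ.≤ M ℕ.^ u →
  4 ℕ.* (m ℕ.* J) ℕ.≤ C ℕ.* ((m ℕ.+ b) ℕ.* n) →
  (+ J) / 1 <ᶜ lower (fromℚ ((+ suc C) / 1))
    *ᶜ (⌊ 1ℚ ⌋ +ᶜ (M ^ʳ (+ 3 / 4)) *ᶜ (p ^ʳ (-[1+ 0 ] / 4)))
    *ᶜ (M ^ᶜ S)
cut-bound {J} {M} {p} {n} {m@(suc _)} {b} {C} {S} {ρ} {u} 1≤M 1≤n 1≤b 1≤C b⁴≤M³ p<m⁴ Sρ ↥ρ≡u n^v≤M^u bound =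
  c ℚ.* t , s , subst (0ℚ ℚ.<_) (sym ct≡) (/-positive (C ℕ.* (m ℕ.+ b)) (1 ℕ.* (2 ℕ.* m)) 1≤Cmb)
  , /-positive n 2 1≤n
  , (c , t , /-positive C 1 1≤C , /-positive (m ℕ.+ b) (2 ℕ.* m) (ℕ.s≤s ℕ.z≤n) , c<c+1 , t<T , ℚ.≤-refl)
  , (ρ , Sρ , inj₂ (subst (λ i → PowerBelow s M i (↧ₙ ρ)) (sym ↥ρ≡u) (power-below n M u (↧ₙ ρ) 1≤M n^v≤M^u)))
  , subst ((+ J) / 1 ℚ.≤_) (sym cts≡) (/-mono-≤ J 1 (C ℕ.* (m ℕ.+ b) ℕ.* n) (1 ℕ.* (2 ℕ.* m) ℕ.* 2) final)
  where
  -- t equals 1/2 + (b/2)(1/m), so c t s = C (m + b) n / (4 m); hence the factor 4 in `bound`.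
  c t s : ℚ
  c = (+ C) / 1
  t = (+ (m ℕ.+ b)) / (2 ℕ.* m)
  s = (+ n) / 2
  1≤Cmb : 1 ℕ.≤ C ℕ.* (m ℕ.+ b)
  1≤Cmb = ℕ.*-mono-≤ 1≤C (ℕ.s≤s ℕ.z≤n)
  ct≡ : c ℚ.* t ≡ (+ (C ℕ.* (m ℕ.+ b))) / (1 ℕ.* (2 ℕ.* m))
  ct≡ = /-* C 1 (m ℕ.+ b) (2 ℕ.* m)
  cts≡ : c ℚ.* t ℚ.* s ≡ (+ (C ℕ.* (m ℕ.+ b) ℕ.* n)) / (1 ℕ.* (2 ℕ.* m) ℕ.* 2)
  cts≡ = trans (cong (ℚ._* s) ct≡) (/-* (C ℕ.* (m ℕ.+ b)) (1 ℕ.* (2 ℕ.* m)) n 2)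
  c<c+1 : c ℚ.< (+ suc C) / 1
  c<c+1 = /-mono-< C 1 (suc C) 1 (ℕ.*-monoˡ-< 1 (ℕ.n<1+n C))
  b/2m≡ : ((+ b) / 2) ℚ.* ((+ 1) / m) ≡ (+ (b ℕ.* 1)) / (2 ℕ.* m)
  b/2m≡ = /-* b 2 1 m
  t<T : (⌊ 1ℚ ⌋ +ᶜ (M ^ʳ (+ 3 / 4)) *ᶜ (p ^ʳ (-[1+ 0 ] / 4))) t
  t<T = (+ 1) / 2 , ((+ b) / 2) ℚ.* ((+ 1) / m)
    , /-mono-< 1 2 1 1 (ℕ.n<1+n 1)
    , ((+ b) / 2 , (+ 1) / m , /-positive b 2 1≤b , /-positive 1 m (ℕ.s≤s ℕ.z≤n)
      , inj₂ (power-below b M 3 4 1≤M b⁴≤M³) , inj₂ (inverse-power-below m p p<m⁴) , ℚ.≤-refl)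
    , subst (t ℚ.≤_) (sym (trans (cong ((+ 1) / 2 ℚ.+_) b/2m≡) (/-+ 1 2 (b ℕ.* 1) (2 ℕ.* m))))
        (/-mono-≤ (m ℕ.+ b) (2 ℕ.* m) (1 ℕ.* (2 ℕ.* m) ℕ.+ b ℕ.* 1 ℕ.* 2) (2 ℕ.* (2 ℕ.* m)) (ℕ.≤-reflexive (half-sum m b)))
    where
    half-sum : ∀ m b → (m ℕ.+ b) ℕ.* (2 ℕ.* (2 ℕ.* m)) ≡ (1 ℕ.* (2 ℕ.* m) ℕ.+ b ℕ.* 1 ℕ.* 2) ℕ.* (2 ℕ.* m)
    half-sum = ℕ-solver.solve-∀
  final : J ℕ.* (1 ℕ.* (2 ℕ.* m) ℕ.* 2) ℕ.≤ C ℕ.* (m ℕ.+ b) ℕ.* n ℕ.* 1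
  final = subst₂ ℕ._≤_ (lem m J) (trans (sym (ℕ.*-assoc C (m ℕ.+ b) n)) (sym (ℕ.*-identityʳ _))) bound
    where
    lem : ∀ m J → 4 ℕ.* (m ℕ.* J) ≡ J ℕ.* (1 ℕ.* (2 ℕ.* m) ℕ.* 2)
    lem = ℕ-solver.solve-∀

-- Modular powers

coprime⇒∤ : ∀ {p} → Prime p → ∀ a → Coprimeℤ a (+ p) → ¬ + p ℤ.∣ a
coprime⇒∤ pp a coprime p∣a with coprime (ℤ.∣⇒∣ᵤ p∣a , ℕ.∣-refl)
... | refl = case pp of λ ()

module _ {p g : ℕ} (pp : Prime p) (coprime : Coprime g p) where

  inverse-∤ : ¬ + p ℤ.∣ inverse g p
  inverse-∤ p∣inv = contradiction (ℕ.∣1⇒≡1 (ℤ.∣⇒∣ᵤ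
    (subst (+ p ℤ.∣_) (lem (+ g ℤ.* inverse g p) (+ 1)) (ℤ.∣m∣n⇒∣m-n (ℤ.∣n⇒∣m*n (+ g) p∣inv) (inverse-correct coprime)))))
    λ { refl → case pp of λ () }
    where
    lem : ∀ a b → a ℤ.- (a ℤ.- b) ≡ b
    lem = ℤ-solver.solve-∀

  powMod-∤ : ∀ x → ¬ + p ℤ.∣ powMod p g x
  powMod-∤ (+ n)      = ∤-^ pp (coprime⇒∤ pp (+ g) coprime) n
  powMod-∤ -[1+ n ] = ∤-^ pp inverse-∤ (suc n)

  -- At a negative exponent one factor `inverse g p` cancels against g; this is the only place where
  -- the two halves of `powMod` have to be glued.
  powMod-suc : ∀ x → powMod p g (x ℤ.+ + 1) ≡ powMod p g x ℤ.* + g [mod p ]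
  powMod-suc (+ n) = subst (+ p ℤ.∣_) (sym (ℤ.i≡j⇒i-j≡0 eq)) (divides 0ℤ refl)
    where
    eq : (+ g) ℤ.^ (n ℕ.+ 1) ≡ (+ g) ℤ.^ n ℤ.* + g
    eq = trans (ℤ.^-distribˡ-+-* (+ g) n 1) (cong ((+ g) ℤ.^ n ℤ.*_) (ℤ.*-identityʳ (+ g)))
  powMod-suc -[1+ zero ] = subst (+ p ℤ.∣_) (lem (+ g) (inverse g p)) (ℤ.∣m⇒∣-m (inverse-correct coprime))
    where
    lem : ∀ g i → ℤ.- (g ℤ.* i ℤ.- + 1) ≡ + 1 ℤ.- i ℤ.* + 1 ℤ.* g
    lem = ℤ-solver.solve-∀
  powMod-suc -[1+ suc n ] = subst (+ p ℤ.∣_) (lem (+ g) (inverse g p) (inverse g p ℤ.^ n))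
    (ℤ.∣n⇒∣m*n (ℤ.- (inverse g p ℤ.^ suc n)) (inverse-correct coprime))
    where
    lem : ∀ g i x → (ℤ.- (i ℤ.* x)) ℤ.* (g ℤ.* i ℤ.- + 1) ≡ i ℤ.* x ℤ.- i ℤ.* (i ℤ.* x) ℤ.* g
    lem = ℤ-solver.solve-∀

  powMod-+ : ∀ x n → powMod p g (x ℤ.+ + n) ≡ powMod p g x ℤ.* (+ g) ℤ.^ n [mod p ]
  powMod-+ x zero = subst (+ p ℤ.∣_)
    (sym (ℤ.i≡j⇒i-j≡0 (trans (cong (powMod p g) (ℤ.+-identityʳ x)) (sym (ℤ.*-identityʳ _))))) (divides 0ℤ refl)
  powMod-+ x (suc n) = subst (+ p ℤ.∣_)
    (trans (lem (powMod p g (x ℤ.+ + n ℤ.+ + 1)) (powMod p g (x ℤ.+ + n)) (powMod p g x) ((+ g) ℤ.^ n) (+ g))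
      (cong (λ y → powMod p g y ℤ.- powMod p g x ℤ.* (+ g ℤ.* (+ g) ℤ.^ n)) x+n+1))
    (ℤ.∣m∣n⇒∣m+n (powMod-suc (x ℤ.+ + n)) (ℤ.∣m⇒∣m*n (+ g) (powMod-+ x n)))
    where
    lem : ∀ a b c d g → (a ℤ.- b ℤ.* g) ℤ.+ (b ℤ.- c ℤ.* d) ℤ.* g ≡ a ℤ.- c ℤ.* (g ℤ.* d)
    lem = ℤ-solver.solve-∀
    x+n+1 : x ℤ.+ + n ℤ.+ + 1 ≡ x ℤ.+ + suc n
    x+n+1 = trans (ℤ.+-assoc x (+ n) (+ 1)) (cong (λ k → x ℤ.+ + k) (ℕ.+-comm n 1))

-- Translation to offsets and the integer bound for J

module _ {p g t : ℕ} (pp : Prime p) (coprime : Coprime g p) (order : IsMultiplicativeOrder p g t)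
  {M : ℕ} (1≤M : 1 ≤ M) (M<t : M < t) {a : ℤ} (p∤a : ¬ + p ℤ.∣ a) (K L : ℤ) where

  private
    c : ℤ
    c = a ℤ.* powMod p g (K ℤ.+ + 1)

    p∤c : ¬ + p ℤ.∣ c
    p∤c p∣c = [ p∤a , powMod-∤ pp coprime (K ℤ.+ + 1) ]′ (euclidsLemmaℤ pp a p∣c)

  open Points pp (coprime⇒∤ pp (+ g) coprime) order 1≤M M<t c p∤c L public

  Jₐ-points : Σ[ xs ∈ List (ℕ × ℕ) ] Unique xs × All Point xs × Jₐ p g a M K L ≤ length xs
  Jₐ-points = map shift indices
    , Unique.map⁺ shift-injective unique-indices
    , All.map⁺ (All.tabulate λ ij∈ → index-point (∈-filter⁻ (onCurve? p g a ∘ coordinates) {xs = square} ij∈))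
    , (begin
      Jₐ p g a M K L                    ≤⟨ atMost-injective (≡-dec ℤ._≟_ ℤ._≟_) id (map coordinates indices)
                                             covered (λ _ _ eq → eq) unique-curve (All.tabulate id) ⟩
      length (map coordinates indices)  ≡⟨ length-map coordinates indices ⟩
      length indices                    ≡⟨ sym (length-map shift indices) ⟩
      length (map shift indices)        ∎)
    where
    open ℕ.≤-Reasoning
    -- The two unit shifts are treated differently: the one in x goes into `c`, the one in y stays
    -- in the offset.
    shift : ℕ × ℕ → ℕ × ℕ
    shift (i , j) = i , suc j
    shift-injective : ∀ {ij ij′} → shift ij ≡ shift ij′ → ij ≡ ij′
    shift-injective refl = refl
    coordinates : ℕ × ℕ → ℤ × ℤ
    coordinates (i , j) = K ℤ.+ + suc i , L ℤ.+ + suc j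
    square indices : List (ℕ × ℕ)
    square  = cartesianProduct (upTo M) (upTo M)
    indices = filter (onCurve? p g a ∘ coordinates) square
    unique-indices : Unique indices
    unique-indices = Unique.filter⁺ (onCurve? p g a ∘ coordinates)
      (Unique.cartesianProduct⁺ (Unique.upTo⁺ M) (Unique.upTo⁺ M))
    curve : List (ℤ × ℤ)
    curve = filter (onCurve? p g a) (cartesianProduct (interval K M) (interval L M))
    unique-interval : ∀ K → Unique (interval K M)
    unique-interval K = Unique.map⁺ (λ eq → ℕ.suc-injective (ℤ.+-injective (∙-cancelˡ ℤ.+-0-abelianGroup K _ _ eq))) (Unique.upTo⁺ M)
    unique-curve : Unique curve
    unique-curve = Unique.filter⁺ (onCurve? p g a) (Unique.cartesianProduct⁺ (unique-interval K) (unique-interval L))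
    covered : ∀ {xy} → xy ∈ curve → xy ∈ map coordinates indices
    covered {xy} xy∈ with ∈-filter⁻ (onCurve? p g a) {xs = cartesianProduct (interval K M) (interval L M)} xy∈
    ... | xy∈box , on with ∈-cartesianProduct⁻ (interval K M) (interval L M) xy∈box
    ... | x∈ , y∈ with ∈-map⁻ (λ i → K ℤ.+ + suc i) x∈ | ∈-map⁻ (λ j → L ℤ.+ + suc j) y∈
    ... | i , i∈ , refl | j , j∈ , refl =
      ∈-map⁺ coordinates (∈-filter⁺ (onCurve? p g a ∘ coordinates) (∈-cartesianProduct⁺ i∈ j∈) on)
    index-point : ∀ {ij} → ij ∈ square × OnCurve p g a (coordinates ij) → Point (shift ij)
    index-point {i , j} (ij∈ , on) with ∈-cartesianProduct⁻ (upTo M) (upTo M) ij∈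
    ... | i∈ , j∈ = point (∈-upTo⁻ i∈) (∈-upTo⁻ j∈) (subst (+ p ℤ.∣_)
        (lem (L ℤ.+ + suc j) a (powMod p g (K ℤ.+ + suc i)) (powMod p g (K ℤ.+ + 1)) ((+ g) ℤ.^ i))
        (ℤ.∣m∣n⇒∣m+n on (ℤ.∣n⇒∣m*n a (subst (λ x → powMod p g x ≡ powMod p g (K ℤ.+ + 1) ℤ.* (+ g) ℤ.^ i [mod p ])
          (ℤ.+-assoc K (+ 1) (+ i)) (powMod-+ pp coprime (K ℤ.+ + 1) i)))))
      where
      lem : ∀ y a x G P → (y ℤ.- a ℤ.* x) ℤ.+ a ℤ.* (x ℤ.- G ℤ.* P) ≡ y ℤ.- a ℤ.* G ℤ.* P
      lem = ℤ-solver.solve-∀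

  Jₐ-bound : ∀ {v C} .{{_ : NonZero v}} → 1 ≤ C →
    (∀ N → 1 ≤ N → DivisorBound (v ℕ.* 4) C N) →
    ∀ {u m b n} → v < 2 ℕ.* u →
    m ℕ.^ 4 ≤ 16 ℕ.* p → M ℕ.^ 3 ≤ 16 ℕ.* b ℕ.^ 4 → M ℕ.^ u ≤ (2 ℕ.* n) ℕ.^ v →
    4 ℕ.* (m ℕ.* Jₐ p g a M K L) ≤ 160 ℕ.* divisor-constant v C ℕ.* ((m ℕ.+ b) ℕ.* n)
  Jₐ-bound {v} {C} 1≤C bound {u} {m} {b} {n} v<2u m⁴≤ M³≤ M^u≤ =
    let instance
          _ = prime⇒nonZero pp
          _ = ℕ.>-nonZero 1≤M
        E = divisor-constant v C
        1≤E = 1≤divisor-constant v 1≤C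
        -- R is the floor of √(p / M), positive because M < p; hence also p < 4 R² M.
        R , R²M≤p , p< = floorInverse (λ R → R ℕ.* R ℕ.* M) refl
          (λ n → ℕ.*-monoˡ-< M (ℕ.*-mono-< (ℕ.n<1+n n) (ℕ.n<1+n n))) p
        1≤R = R≥1 R p<
        instance _ = ℕ.>-nonZero 1≤R
        -- D is the floor of the v-th root of E M, so it bounds every natural f with f ^ v ≤ E M.
        D , D^v≤ , EM< = floorRoot v (E ℕ.* M)
        -- The least Q with 3 M < Q R, which therefore also satisfies Q R ≤ 3 M + R.
        Q = suc (3 ℕ.* M ℕ./ R)
        r , L₀ , h , 1≤r , r≤R , rL≡ , RL₀<p = dirichlet p R L
        xs , unique , points , J≤ = Jₐ-points
        open Reduced {r} {R} {L₀} {h} 1≤r r≤R (ℕ.≤-<-trans r≤R (R<p R R²M≤p)) rL≡ RL₀<p R²M≤p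
               {Q} (3M<QR R) {v ℕ.* 4} {C} {D} 1≤C bound
               (λ f f≤ → ℕ.≮⇒≥ λ D<f → ℕ.<⇒≱ (ℕ.<-≤-trans EM< (ℕ.^-monoˡ-≤ v D<f)) (root-bound {v} {C} {M} {f} 1≤C f≤))
    in curve-estimate {M} {p} {Jₐ p g a M K L} {R} {Q} {D} {b} {m} {n} {E} 1≤R 1≤E
         (ℕ.≤-trans (ℕ.*-mono-≤ J≤ J≤) (points-bound unique points))
         (subst (_≤ 3 ℕ.* M ℕ.+ R) (ℕ.+-comm _ R) (ℕ.+-monoˡ-≤ R (ℕ.m/n*n≤m (3 ℕ.* M) R)))
         (ℕ.<⇒≤ (ℕ.<-≤-trans p< (quadruple R 1≤R)))
         m⁴≤ M³≤
         (M*D-bound {v} {u} {M} {D} {n} {E} 1≤M 1≤E v<2u D^v≤ M^u≤)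
    where
    open ℕ.≤-Reasoning
    instance _ = prime⇒nonZero pp
    instance _ = ℕ.>-nonZero 1≤M
    M<p : M < p
    M<p = ℕ.<-≤-trans M<t (Powers.order≤p pp (coprime⇒∤ pp (+ g) coprime) order)
    R≥1 : ∀ R → p < suc R ℕ.* suc R ℕ.* M → 1 ≤ R
    R≥1 zero    p<M = contradiction (subst (p <_) (ℕ.*-identityˡ M) p<M) (ℕ.<⇒≯ M<p)
    R≥1 (suc R) _   = s≤s z≤n
    R<p : ∀ R → R ℕ.* R ℕ.* M ≤ p → R < p
    R<p R R²M≤p = ℕ.≰⇒> λ p≤R → ℕ.<-irrefl refl (begin-strict
      p               <⟨ ℕ.m<m*n p p (ℕ.nonTrivial⇒n>1 p {{prime⇒nonTrivial pp}}) ⟩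
      p ℕ.* p         ≤⟨ ℕ.*-mono-≤ p≤R p≤R ⟩
      R ℕ.* R         ≤⟨ ℕ.m≤m*n (R ℕ.* R) M ⟩
      R ℕ.* R ℕ.* M   ≤⟨ R²M≤p ⟩
      p               ∎)
    3M<QR : ∀ R .{{_ : NonZero R}} → 3 ℕ.* M < suc (3 ℕ.* M ℕ./ R) ℕ.* R
    3M<QR R = begin-strict
      3 ℕ.* M                                          ≡⟨ ℕ.m≡m%n+[m/n]*n (3 ℕ.* M) R ⟩
      3 ℕ.* M ℕ.% R ℕ.+ 3 ℕ.* M ℕ./ R ℕ.* R            <⟨ ℕ.+-monoˡ-< (3 ℕ.* M ℕ./ R ℕ.* R) (ℕ.m%n<n (3 ℕ.* M) R) ⟩
      suc (3 ℕ.* M ℕ./ R) ℕ.* R                        ∎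
    quadruple : ∀ R → 1 ≤ R → suc R ℕ.* suc R ℕ.* M ≤ 4 ℕ.* (R ℕ.* R ℕ.* M)
    quadruple R 1≤R = begin
      suc R ℕ.* suc R ℕ.* M               ≤⟨ ℕ.*-monoˡ-≤ M (ℕ.*-mono-≤ (suc≤2* 1≤R) (suc≤2* 1≤R)) ⟩
      2 ℕ.* R ℕ.* (2 ℕ.* R) ℕ.* M         ≡⟨ cong (ℕ._* M) (ℕ.[m*n]*[o*p]≡[m*o]*[n*p] 2 R 2 R) ⟩
      4 ℕ.* (R ℕ.* R) ℕ.* M               ≡⟨ ℕ.*-assoc 4 (R ℕ.* R) M ⟩
      4 ℕ.* (R ℕ.* R ℕ.* M)               ∎

corollary3 : (ε : ℝ) → Positive ε →
    Σ[ p₀ ∈ ℕ ] Σ[ c ∈ ℝ ] Positive c ×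
    (∀ (p : ℕ) → Prime p → p₀ ≤ p →
    ∀ (g : ℕ) → 2 ≤ g → Coprime g p →
    ∀ (t : ℕ) → IsMultiplicativeOrder p g t →
    ∀ (M : ℕ) → 1 ≤ M → M < t →
    ∀ (a : ℤ) → Coprimeℤ a (+ p) →
    ∀ (K L : ℤ) →
    (+ Jₐ p g a M K L) / 1
    <ᶜ lower c
    *ᶜ (⌊ 1ℚ ⌋ +ᶜ (M ^ʳ (+ 3 / 4)) *ᶜ (p ^ʳ (-[1+ 0 ] / 4)))
    *ᶜ (M ^ᶜ (⌊ + 1 / 2 ⌋ +ᶜ lower ε)))
corollary3 ε ε>0 =
  let ρ , ½<ρ , ρ<½+ε = exponent-above-½ ε ε>0
      u , ↥ρ≡u , v<2u = ½<⇒↧<2↥ ρ ½<ρ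
      v = ↧ₙ ρ
      A , 1≤A , divisors = divisorBound (v ℕ.* 4)
      E = divisor-constant v A
      C = 160 ℕ.* E
      1≤C = ℕ.*-mono-≤ {1} {160} {1} {E} (s≤s z≤n) (1≤divisor-constant v 1≤A)
  in 0 , fromℚ ((+ suc C) / 1) , /-positive (suc C) 1 (s≤s z≤n) ,
     λ p pp _ g _ coprime t order M 1≤M M<t a coprime-a K L →
       -- `suc f` overestimates p ^ 1/4, whose inverse is used, whereas b and n underestimate M ^
       -- 3/4 and M ^ ρ.
       let f , f⁴≤p , p<m⁴ = floorRoot 4 p
           b , b⁴≤M³ , M³< = floorRoot 4 (M ℕ.^ 3)
           n , n^v≤M^u , M^u< = floorRoot v (M ℕ.^ u)
           1≤p = ℕ.>-nonZero⁻¹ p {{prime⇒nonZero pp}}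
       in cut-bound {Jₐ p g a M K L} {M} {p} {n} {suc f} {b} {C} {⌊ + 1 / 2 ⌋ +ᶜ lower ε} {ρ} {u}
            1≤M (floorRoot≥1 v {M ℕ.^ u} {n} (1≤^ u 1≤M) M^u<) (floorRoot≥1 4 {M ℕ.^ 3} {b} (1≤^ 3 1≤M) M³<) 1≤C
            b⁴≤M³ p<m⁴ ρ<½+ε ↥ρ≡u n^v≤M^u
            (Jₐ-bound pp coprime order 1≤M M<t (coprime⇒∤ pp a coprime-a) K L {v} {A} 1≤A divisors {u} {suc f} {b} {n} v<2u
              (suc-root-≤ {p} {f} 1≤p f⁴≤p p<m⁴)
              (ℕ.≤-trans (floorRoot-double 4 {M ℕ.^ 3} {b} (1≤^ 3 1≤M) M³<) (ℕ.≤-reflexive (^-distribʳ-* 4 2 b)))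
              (floorRoot-double v {M ℕ.^ u} {n} (1≤^ u 1≤M) M^u<))
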